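{- Let $G$ be a graph, let $k$ be its branch-depth and let $t$ be its tree-depth. Then \[ k-1\le t\le \max(2k^2-k+1,2). \]
   Context: Graphs are finite and may have loops and parallel edges. A connectivity function on a finite set $E$ is a function $\lambda:2^E\to\mathbb{Z}$ with $\lambda(\emptyset)=0$, $\lambda(X)=\lambda(E\setminus X)$ for all $X$, and $\lambda(X)+\lambda(Y)\ge\lambda(X\cup Y)+\lambda(X\cap Y)$ for all $X,Y$. The radius of a tree is the minimum $r$ such that some node has distance at most $r$ from every node. A decomposition of $\lambda$ is a pair $(T,\sigma)$ where $T$ is a tree with at least one internal (non-leaf) node and $\sigma$ is a bijection from $E$ to the set of leaves of $T$; its radius is the radius of $T$. For an internal node $v$, the components of $T-v$ induce (via $\sigma$) a partition $\mathcal P_v$ of $E$, and the width of $v$ is $\max_{\mathcal P'\subseteq\mathcal P_v}\lambda(\bigcup_{X\in\mathcal P'}X)$; the width of $(T,\sigma)$ is the maximum width of an internal node. A $(k,r)$-decomposition is a decomposition of width at most $k$ and radius at most $r$. The branch-depth of $\lambda$ is the minimum $k$ such that $\lambda$ has a $(k,k)$-decomposition; if $|E|<2$ the branch-depth is defined to be $0$. For a graph $G=(V,E)$ and $X\subseteq E$, $\lambda_G(X)$ is the number of vertices incident with both an edge in $X$ and an edge in $E\setminus X$; the branch-depth of $G$ is the branch-depth of $\lambda_G$. Tree-depth: a rooted forest has a root in each component with edges oriented away from roots; its closure is the simple graph on its vertex set in which two vertices are adjacent iff there is a directed path from one to the other; its height is the number of vertices of a longest directed path. The tree-depth of a simple graph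 $G$ is the minimum height of a rooted forest whose closure contains $G$ as a subgraph; the tree-depth of a general graph is that of its simplification. -}

module Defs where

open import Data.Nat using (ℕ; zero; suc; _+_; _≤_; _<_)
open import Data.Bool using (Bool; true; false; _∧_; _∨_; not; if_then_else_)
open import Data.Fin using (Fin; zero; suc; inject₁; fromℕ; _≟_)
open import Data.Product using (Σ; _×_; _,_; ∃; proj₁; proj₂)
open import Data.Sum using (_⊎_)
open import Data.Maybe using (Maybe; just; nothing)
open import Relation.Binary.PropositionalEquality using (_≡_; _≢_)
open import Relation.Nullary using (¬_; does)
open import Function.Definitions using (Injective)

count : ∀ {n} → (Fin n → Bool) → ℕ
count {zero}  f = 0
count {suc n} f = (if f zero then 1 else 0) + count (λ i → f (suc i))

anyFin : ∀ {n} → (Fin n → Bool) → Bool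
anyFin {zero}  f = false
anyFin {suc n} f = f zero ∨ anyFin (λ i → f (suc i))

-- Finite multigraphs (loops and parallel edges allowed):
-- vertices Fin nV, edges Fin nE, each edge has two ends (equal ends = loop).

record Graph : Set where
  field
    nV   : ℕ
    nE   : ℕ
    ends : Fin nE → Fin nV × Fin nV

open Graph public

incident : (G : Graph) → Fin (nE G) → Fin (nV G) → Bool
incident G e v = does (proj₁ (ends G e) ≟ v) ∨ does (proj₂ (ends G e) ≟ v)

λG : (G : Graph) → (Fin (nE G) → Bool) → ℕ
λG G X = count (λ v → anyFin (λ e → X e ∧ incident G e v)
                    ∧ anyFin (λ e → not (X e) ∧ incident G e v))

module _ {p : ℕ} (adj : Fin p → Fin p → Bool) where

  degree : Fin p → ℕ
  degree x = count (adj x)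

  IsLeaf : Fin p → Set
  IsLeaf x = degree x ≤ 1

  IsInternal : Fin p → Set
  IsInternal x = 2 ≤ degree x

  data WalkLen : ℕ → Fin p → Fin p → Set where
    wnil  : ∀ {x} → WalkLen 0 x x
    wcons : ∀ {x y z l} → adj x y ≡ true → WalkLen l y z → WalkLen (suc l) x z

  Connected : Set
  Connected = ∀ x y → ∃ λ l → WalkLen l x y

  record Cycle : Set where
    field
      len   : ℕ
      vert  : Fin (3 + len) → Fin p
      inj   : Injective _≡_ _≡_ vert
      steps : ∀ (i : Fin (2 + len)) → adj (vert (inject₁ i)) (vert (suc i)) ≡ true
      close : adj (vert (fromℕ (2 + len))) (vert zero) ≡ true

  IsTree : Set
  IsTree = (∀ x y → adj x y ≡ adj y x) × (∀ x → adj x x ≡ false)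
         × Connected × ¬ Cycle

  data AvoidWalk (v : Fin p) : Fin p → Fin p → Set where
    anil  : ∀ {x} → x ≢ v → AvoidWalk v x x
    acons : ∀ {x y z} → x ≢ v → adj x y ≡ true → AvoidWalk v y z → AvoidWalk v x z

  RadiusAtMost : ℕ → Set
  RadiusAtMost r = ∃ λ c → ∀ x → ∃ λ l → l ≤ r × WalkLen l c x

record Decomposition (m : ℕ) : Set where
  field
    nodes       : ℕ
    tadj        : Fin nodes → Fin nodes → Bool
    isTree      : IsTree tadj
    hasInternal : ∃ λ v → IsInternal tadj v
    σ           : Fin m → Fin nodes
    σ-inj       : Injective _≡_ _≡_ σ
    σ-leaf      : ∀ e → IsLeaf tadj (σ e)
    σ-onto      : ∀ x → IsLeaf tadj x → ∃ λ e → σ e ≡ x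

open Decomposition public

-- e and f lie in the same part of 𝒫_v (same component of T - v)
SamePart : ∀ {m} (D : Decomposition m) → Fin (nodes D) → Fin m → Fin m → Set
SamePart D v e f = AvoidWalk (tadj D) v (σ D e) (σ D f)

UnionOfParts : ∀ {m} (D : Decomposition m) → Fin (nodes D) → (Fin m → Bool) → Set
UnionOfParts D v X = ∀ e f → SamePart D v e f → X e ≡ X f

WidthAtMost : ∀ {m} → ((Fin m → Bool) → ℕ) → Decomposition m → ℕ → Set
WidthAtMost λf D k =
  ∀ v → IsInternal (tadj D) v → ∀ X → UnionOfParts D v X → λf X ≤ k

HasDecomposition : ∀ {m} → ((Fin m → Bool) → ℕ) → ℕ → ℕ → Set
HasDecomposition {m} λf k r =
  Σ (Decomposition m) λ D → WidthAtMost λf D k × RadiusAtMost (tadj D) r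

IsBranchDepthOf : ∀ {m} → ((Fin m → Bool) → ℕ) → ℕ → Set
IsBranchDepthOf {m} λf k =
  (m < 2 × k ≡ 0)
  ⊎ (2 ≤ m × HasDecomposition λf k k × (∀ j → HasDecomposition λf j j → k ≤ j))

IsBranchDepth : Graph → ℕ → Set
IsBranchDepth G k = IsBranchDepthOf (λG G) k

record RootedForest : Set where
  field
    size   : ℕ
    parent : Fin size → Maybe (Fin size)

open RootedForest public

data Depth (F : RootedForest) : Fin (size F) → ℕ → Set where
  root  : ∀ {x} → parent F x ≡ nothing → Depth F x 1
  child : ∀ {x y d} → parent F x ≡ just y → Depth F y d → Depth F x (suc d)

data Anc (F : RootedForest) : Fin (size F) → Fin (size F) → Set where
  par : ∀ {x y} → parent F y ≡ just x → Anc F x y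
  up  : ∀ {x y z} → parent F y ≡ just z → Anc F x z → Anc F x y

-- parent pointers form a genuine rooted forest (no cycles)
IsRootedForest : RootedForest → Set
IsRootedForest F = ∀ x → ∃ λ d → Depth F x d

HeightAtMost : RootedForest → ℕ → Set
HeightAtMost F h = ∀ x d → Depth F x d → d ≤ h

-- the closure of F contains the simplification of G as a subgraph
ClosureContains : RootedForest → Graph → Set
ClosureContains F G =
  Σ (Fin (nV G) → Fin (size F)) λ φ → Injective _≡_ _≡_ φ ×
    (∀ e → proj₁ (ends G e) ≢ proj₂ (ends G e) →
       Anc F (φ (proj₁ (ends G e))) (φ (proj₂ (ends G e)))
       ⊎ Anc F (φ (proj₂ (ends G e))) (φ (proj₁ (ends G e))))

HasForestOfHeight : Graph → ℕ → Set
HasForestOfHeight G h =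
  Σ RootedForest λ F → IsRootedForest F × HeightAtMost F h × ClosureContains F G

IsTreeDepth : Graph → ℕ → Set
IsTreeDepth G t = HasForestOfHeight G t × (∀ h → HasForestOfHeight G h → t ≤ h)

{-# OPTIONS --safe #-}

-- Lower bound on t: given a rooted forest F of height t whose closure contains G, attach every edge of G
-- as a leaf to a vertex of F below both of its ends, join the roots of F to a new root, and prune. Only
-- ancestors of v meet two parts of 𝒫_v, so the width is at most t, while the radius is at most t + 1.
-- One edge e₀ is attached to the new root instead, which keeps that root from becoming a leaf.
--
-- Upper bound on t: let (T , σ) have width and radius at most k and let B_v be the set of vertices meeting
-- several parts of 𝒫_v. A random union of parts separates each x in B_v with probability at least 1/2, and
-- the empty union separates none, so |B_v| < 2k. Root T at a centre and replace every internal node v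
-- by a chain of 2k - 1 positions for the x whose topmost B_v is this one. For an edge xy both topmost nodes are
-- ancestors of the leaf of xy, hence comparable. A vertex in no B_v meets at most one edge and is
-- hung below its neighbour, at the cost of one more level.

module Submission where

open import Defs
open import Data.Nat using (ℕ; zero; suc; _+_; _*_; _∸_; _⊔_; _≤_; _<_; z≤n; s≤s; s≤s⁻¹; _≤?_; _<?_; _/_)
open import Data.Nat.Properties hiding (_≟_; suc-injective)
import Data.Nat.Properties as ℕₚ
open import Data.Nat.DivMod using (/-monoˡ-≤; +-distrib-/-∣ʳ; m<n⇒m/n≡0; m*n/n≡m)
open import Data.Nat.Divisibility using (n∣m*n)
open import Data.Nat.Tactic.RingSolver using (solve-∀)
open import Data.Bool using (Bool; true; false; _∧_; _∨_; not; if_then_else_; _xor_)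
open import Data.Bool.Properties using (∨-comm; ¬-not) renaming (_≟_ to _≟ᵇ_)
open import Data.Fin
  using (Fin; zero; suc; _≟_; inject₁; fromℕ; fromℕ<; toℕ; combine; remQuot; splitAt; join; _↑ˡ_; _↑ʳ_)
open import Data.Fin.Properties
  using (any?; injective⇒≤; suc-injective; toℕ<n; toℕ-inject₁; toℕ-fromℕ<; toℕ-injective; remQuot-combine;
         combine-injective; splitAt-↑ˡ; splitAt-↑ʳ; join-splitAt; ↑ˡ-injective; ↑ʳ-injective)
open import Data.List as List using (List; []; _∷_; length; allFin)
open import Data.List.Membership.Propositional using (_∈_)
open import Data.List.Membership.Propositional.Properties using (∈-allFin)
import Data.List.Membership.DecPropositional as DecMembership
open import Data.List.Relation.Unary.Any as Any using (here; there)
open import Data.List.Relation.Unary.Any.Properties using (lookup-index)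
open import Data.Vec using (Vec; []; _∷_; lookup)
open import Data.Vec.Relation.Unary.All using (All; []; _∷_)
open import Data.Vec.Relation.Unary.AllPairs using ([]; _∷_)
open import Data.Vec.Relation.Unary.Unique.Propositional using (Unique)
open import Data.Vec.Relation.Unary.Unique.Propositional.Properties using (lookup-injective)
open import Data.Product using (_×_; _,_; ∃; proj₁; proj₂)
open import Data.Sum as Sum using (_⊎_; inj₁; inj₂; swap; [_,_]′)
open import Data.Empty using (⊥; ⊥-elim)
open import Data.Maybe as Maybe using (Maybe; just; nothing; maybe′)
open import Data.Maybe.Properties using (just-injective; ≡-dec)
open import Relation.Binary using (Tri; tri<; tri≈; tri>)
open import Relation.Binary.PropositionalEquality
open import Relation.Binary.Construct.Closure.ReflexiveTransitive using (Star; ε; _◅_; _◅◅_; reverse)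
open import Relation.Nullary using (¬_; Dec; yes; no; does; _×-dec_; ¬?; _⊎-dec_)
open import Relation.Unary using (Decidable)
open import Function.Definitions using (Injective)

-- Counting over finite types

record Enumeration {A : Set} (P : A → Set) (n : ℕ) : Set where
  field
    at   : Fin n → A
    inj  : Injective _≡_ _≡_ at
    sat  : ∀ i → P (at i)
    onto : ∀ {x} → P x → ∃ λ i → at i ≡ x

-- Enumerations reduce inequalities between counts to injections between `Fin` types.
enumerate : ∀ {n} (f : Fin n → Bool) → Enumeration (λ x → f x ≡ true) (count f)
enumerate {zero} f = record
  { at = λ () ; inj = λ {} ; sat = λ () ; onto = λ { {()} } }
enumerate {suc n} f with f zero in eq | enumerate (λ i → f (suc i))
... | true | record { at = at ; inj = inj ; sat = sat ; onto = onto } = record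
  { at   = λ { zero → zero ; (suc i) → suc (at i) }
  ; inj  = λ { {zero} {zero} _ → refl ; {suc i} {suc j} e → cong suc (inj (suc-injective e)) }
  ; sat  = λ { zero → eq ; (suc i) → sat i }
  ; onto = λ { {zero} _ → zero , refl
             ; {suc x} p → suc (proj₁ (onto p)) , cong suc (proj₂ (onto p)) }
  }
... | false | record { at = at ; inj = inj ; sat = sat ; onto = onto } = record
  { at   = λ i → suc (at i)
  ; inj  = λ e → inj (suc-injective e)
  ; sat  = sat
  ; onto = λ { {zero} p → contra (trans (sym eq) p)
             ; {suc x} p → proj₁ (onto p) , cong suc (proj₂ (onto p)) }
  }
  where
  contra : ∀ {A : Set} → false ≡ true → A
  contra ()

count-injection : ∀ {n m} {f : Fin n → Bool} {h : Fin m → Bool}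
  (g : ∀ x → f x ≡ true → Fin m) →
  (∀ {x y} p q → g x p ≡ g y q → x ≡ y) → (∀ x p → h (g x p) ≡ true) →
  count f ≤ count h
count-injection {f = f} {h} g g-inj g-true = injective⇒≤ {f = k} k-inj
  where
  open Enumeration
  ef = enumerate f
  eh = enumerate h
  k : Fin (count f) → Fin (count h)
  k i = proj₁ (onto eh (g-true (at ef i) (sat ef i)))
  k-at : ∀ i → at eh (k i) ≡ g (at ef i) (sat ef i)
  k-at i = proj₂ (onto eh (g-true (at ef i) (sat ef i)))
  k-inj : Injective _≡_ _≡_ k
  k-inj {i} {j} e = inj ef (g-inj _ _ (trans (sym (k-at i)) (trans (cong (at eh) e) (k-at j))))

count-true : ∀ n → count {n} (λ _ → true) ≡ n
count-true zero    = refl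
count-true (suc n) = cong suc (count-true n)

count≤ : ∀ {n m} {f : Fin n → Bool} (g : ∀ x → f x ≡ true → Fin m) →
  (∀ {x y} p q → g x p ≡ g y q → x ≡ y) → count f ≤ m
count≤ {m = m} {f} g g-inj =
  subst (count f ≤_) (count-true m) (count-injection g g-inj (λ _ _ → refl))

count≤1 : ∀ {n} {f : Fin n → Bool} → (∀ x y → f x ≡ true → f y ≡ true → x ≡ y) → count f ≤ 1
count≤1 unique = count≤ {m = 1} (λ _ _ → zero) (λ p q _ → unique _ _ p q)

2≤count : ∀ {n} {f : Fin n → Bool} {x y} → x ≢ y → f x ≡ true → f y ≡ true → 2 ≤ count f
2≤count {n} {f} {x} {y} x≢y fx fy =
  count-injection {2} {f = λ _ → true} {h = f} (λ i _ → g i) (λ _ _ → g-inj) (λ i _ → g-true i)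
  where
  g : Fin 2 → Fin n
  g zero       = x
  g (suc zero) = y
  g-inj : ∀ {i j} → g i ≡ g j → i ≡ j
  g-inj {zero}     {zero}     _ = refl
  g-inj {zero}     {suc zero} e = ⊥-elim (x≢y e)
  g-inj {suc zero} {zero}     e = ⊥-elim (x≢y (sym e))
  g-inj {suc zero} {suc zero} _ = refl
  g-true : ∀ i → f (g i) ≡ true
  g-true zero       = fx
  g-true (suc zero) = fy

-- Booleans as propositions, and minimisation

true≢false : true ≢ false
true≢false ()

∧-true : ∀ {a b} → a ∧ b ≡ true → a ≡ true × b ≡ true
∧-true {true} {true} _ = refl , refl

∧-intro : ∀ {a b} → a ≡ true → b ≡ true → a ∧ b ≡ true
∧-intro refl refl = refl

∨-true : ∀ {a b} → a ∨ b ≡ true → a ≡ true ⊎ b ≡ true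
∨-true {true}  _ = inj₁ refl
∨-true {false} p = inj₂ p

∨-introˡ : ∀ {a b} → a ≡ true → a ∨ b ≡ true
∨-introˡ refl = refl

∨-introʳ : ∀ {a b} → b ≡ true → a ∨ b ≡ true
∨-introʳ {true}  _ = refl
∨-introʳ {false} p = p

does-true : ∀ {P : Set} (d : Dec P) → does d ≡ true → P
does-true (yes p) _ = p

true-does : ∀ {P : Set} (d : Dec P) → P → does d ≡ true
true-does (yes _) _ = refl
true-does (no ¬p) p = ⊥-elim (¬p p)

anyFin-true : ∀ {n} (f : Fin n → Bool) → anyFin f ≡ true → ∃ λ i → f i ≡ true
anyFin-true {suc n} f p with ∨-true {f zero} p
... | inj₁ q = zero , q
... | inj₂ q with anyFin-true (λ i → f (suc i)) q
...   | i , r = suc i , r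

anyFin-intro : ∀ {n} (f : Fin n → Bool) i → f i ≡ true → anyFin f ≡ true
anyFin-intro f zero    p = ∨-introˡ p
anyFin-intro f (suc i) p = ∨-introʳ {f zero} (anyFin-intro (λ j → f (suc j)) i p)

least : ∀ {P : ℕ → Set} → Decidable P → ∀ n → P n → ∃ λ m → P m × (∀ j → P j → m ≤ j)
least P? n p with P? 0
... | yes p₀ = 0 , p₀ , λ _ _ → z≤n
least P? zero    p | no ¬p₀ = ⊥-elim (¬p₀ p)
least P? (suc n) p | no ¬p₀ with least (λ j → P? (suc j)) n p
... | m , pm , min = suc m , pm , λ { zero q → ⊥-elim (¬p₀ q) ; (suc j) q → s≤s (min j q) }

argmin : ∀ {n} {P : Fin n → Set} → Decidable P → (μ : Fin n → ℕ) → ∃ P →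
  ∃ λ x → P x × (∀ y → P y → μ x ≤ μ y)
argmin {P = P} P? μ (x , px) with least dec? (μ x) (x , refl , px)
  where
  dec? : Decidable (λ l → ∃ λ y → μ y ≡ l × P y)
  dec? l = any? (λ y → (μ y ℕₚ.≟ l) ×-dec P? y)
... | _ , (y , refl , py) , min = y , py , λ z pz → min (μ z) (z , refl , pz)

-- Finite sums and the maximum cut

sumFin : ∀ {n} → (Fin n → ℕ) → ℕ
sumFin {zero}  f = 0
sumFin {suc n} f = f zero + sumFin (λ i → f (suc i))

sumFin-mono : ∀ {n} {f g : Fin n → ℕ} → (∀ i → f i ≤ g i) → sumFin f ≤ sumFin g
sumFin-mono {zero}  _ = z≤n
sumFin-mono {suc n} p = +-mono-≤ (p zero) (sumFin-mono (λ i → p (suc i)))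

+-interchange : ∀ a b c d → (a + b) + (c + d) ≡ (a + c) + (b + d)
+-interchange = solve-∀

sumFin-+ : ∀ {n} (f g : Fin n → ℕ) → sumFin (λ i → f i + g i) ≡ sumFin f + sumFin g
sumFin-+ {zero}  f g = refl
sumFin-+ {suc n} f g =
  trans (cong (f zero + g zero +_) (sumFin-+ (λ i → f (suc i)) (λ i → g (suc i))))
        (+-interchange (f zero) (g zero) _ _)

-- The one summand of size 2 is what makes the bound of `max-cut` strict.
sumFin-strict : ∀ {n} {f : Fin n → ℕ} (i : Fin n) → (∀ j → 1 ≤ f j) → 2 ≤ f i → n < sumFin f
sumFin-strict {suc n} {f} zero 1≤f 2≤f = +-mono-≤ 2≤f (all≥1 (λ j → 1≤f (suc j)))
  where
  all≥1 : ∀ {m} {g : Fin m → ℕ} → (∀ j → 1 ≤ g j) → m ≤ sumFin g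
  all≥1 {zero}  _ = z≤n
  all≥1 {suc m} p = +-mono-≤ (p zero) (all≥1 (λ j → p (suc j)))
sumFin-strict {suc n} (suc i) 1≤f 2≤f = +-mono-≤ (1≤f zero) (sumFin-strict i (λ j → 1≤f (suc j)) 2≤f)

sumFin-count : ∀ {n} (f : Fin n → Bool) → sumFin (λ i → if f i then 2 else 0) ≡ 2 * count f
sumFin-count {zero}  f = refl
sumFin-count {suc n} f with f zero
... | true  = trans (cong (2 +_) (sumFin-count (λ i → f (suc i)))) (sym (*-suc 2 (count (λ i → f (suc i)))))
... | false = sumFin-count (λ i → f (suc i))

-- Maximum cut by conditional expectations: `weight` is twice the probability that an edge is cut
-- when the uncoloured ends are coloured uniformly at random.
weight : Maybe Bool → Maybe Bool → ℕ
weight (just s) (just t) = if s xor t then 2 else 0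
weight (just _) nothing  = 1
weight nothing  _        = 1

module _ {p : ℕ} where

  colour : (Fin p → Maybe Bool) → Fin p → Bool → Fin p → Maybe Bool
  colour c u s v = if does (u ≟ v) then just s else c v

  -- Only one end can be `u`, because `x ≢ y`. If the other end is coloured, the two choices for `u`
  -- give weights 2 and 0; if not, they give 1 and 1. Both pairs sum to twice the old weight 1. An
  -- edge that misses `u` is unaffected.
  colour-balanced : ∀ c u {x y} → c u ≡ nothing → x ≢ y →
    weight (c x) (c y) + weight (c x) (c y) ≤
    weight (colour c u true x) (colour c u true y) + weight (colour c u false x) (colour c u false y)
  colour-balanced c u {x} {y} cu x≢y with u ≟ x | u ≟ y
  ... | yes refl | yes refl = ⊥-elim (x≢y refl)
  ... | no _     | no _     = ≤-refl
  ... | yes refl | no _ rewrite cu with c y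
  ...   | nothing    = ≤-refl
  ...   | just true  = ≤-refl
  ...   | just false = ≤-refl
  colour-balanced c u {x} {y} cu x≢y | no _ | yes refl rewrite cu with c x
  ...   | nothing    = ≤-refl
  ...   | just true  = ≤-refl
  ...   | just false = ≤-refl

module _ {n p : ℕ} (a b : Fin n → Fin p) (a≢b : ∀ i → a i ≢ b i) where
  private
    edge : (Fin p → Maybe Bool) → Fin n → ℕ
    edge c i = weight (c (a i)) (c (b i))

    total : (Fin p → Maybe Bool) → ℕ
    total c = sumFin (edge c)

    half : ∀ w x y → w + w ≤ x + y → w ≤ x ⊎ w ≤ y
    half w x y h with w ≤? x | w ≤? y
    ... | yes q | _     = inj₁ q
    ... | no  _ | yes q = inj₂ q
    ... | no q  | no r  = ⊥-elim (<-irrefl refl (≤-trans (s≤s h)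
                            (≤-trans (n≤1+n _) (subst (_≤ w + w) (cong suc (+-suc x y)) (+-mono-≤ (≰⇒> q) (≰⇒> r))))))

    -- Averaging: twice the old total is at most the sum of the two new ones.
    colour-one : ∀ c u → c u ≡ nothing → ∃ λ s → total c ≤ total (colour c u s)
    colour-one c u cu with half (total c) (total (colour c u true)) (total (colour c u false))
      (begin
        total c + total c                                         ≡⟨ sumFin-+ (edge c) (edge c) ⟨
        sumFin (λ i → edge c i + edge c i)                        ≤⟨ sumFin-mono (λ i → colour-balanced c u cu (a≢b i)) ⟩
        sumFin (λ i → edge (colour c u true) i + edge (colour c u false) i)
                                                  ≡⟨ sumFin-+ (edge (colour c u true)) (edge (colour c u false)) ⟩
        total (colour c u true) + total (colour c u false)        ∎)
      where open ≤-Reasoning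
    ... | inj₁ q = true  , q
    ... | inj₂ q = false , q

    Coloured : (Fin p → Maybe Bool) → Fin p → Set
    Coloured c v = ∃ λ s → c v ≡ just s

    colour-keeps : ∀ c u s v → Coloured c v → Coloured (colour c u s) v
    colour-keeps c u s v p with u ≟ v
    ... | yes _ = s , refl
    ... | no _  = p

    colour-sets : ∀ c u s → Coloured (colour c u s) u
    colour-sets c u s with u ≟ u
    ... | yes _ = s , refl
    ... | no q  = ⊥-elim (q refl)

    -- Greedy derandomisation along `us`. Vertices that already have a colour are skipped, since
    -- `colour-one` concerns uncoloured vertices.
    colour-all : ∀ (us : List (Fin p)) c → ∃ λ c′ → total c ≤ total c′ ×
      (∀ v → v ∈ us ⊎ Coloured c v → Coloured c′ v)
    colour-all [] c = c , ≤-refl , λ { v (inj₂ q) → q }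
    colour-all (u ∷ us) c with c u in cu
    ... | just s with colour-all us c
    ...   | c′ , le , all = c′ , le , λ
            { v (inj₁ (here refl)) → all v (inj₂ (s , cu)) ; v (inj₁ (there q)) → all v (inj₁ q)
            ; v (inj₂ q) → all v (inj₂ q) }
    colour-all (u ∷ us) c | nothing with colour-one c u cu
    ... | s , le₁ with colour-all us (colour c u s)
    ...   | c′ , le , all = c′ , ≤-trans le₁ le , λ
            { v (inj₁ (here refl)) → all v (inj₂ (colour-sets c u s)) ; v (inj₁ (there q)) → all v (inj₁ q)
            ; v (inj₂ q) → all v (inj₂ (colour-keeps c u s v q)) }

    -- Weight 0 would need two distinct ends of the same colour, but so far each colour occurs at
    -- one vertex only.
    weight-start : ∀ (u v : Fin p) {x y} → x ≢ y → u ≢ v →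
      1 ≤ weight (colour (colour (λ _ → nothing) u true) v false x) (colour (colour (λ _ → nothing) u true) v false y)
    weight-start u v {x} {y} x≢y u≢v with v ≟ x | v ≟ y
    ... | yes refl | yes refl = ⊥-elim (x≢y refl)
    ... | yes refl | no _ with u ≟ y
    ...   | yes _ = s≤s z≤n
    ...   | no _  = s≤s z≤n
    weight-start u v {x} {y} x≢y u≢v | no _ | yes refl with u ≟ x
    ...   | yes _ = s≤s z≤n
    ...   | no _  = s≤s z≤n
    weight-start u v {x} {y} x≢y u≢v | no _ | no _ with u ≟ x | u ≟ y
    ... | yes refl | yes refl = ⊥-elim (x≢y refl)
    ... | yes _ | no _  = s≤s z≤n
    ... | no _  | _     = s≤s z≤n

    weight-first : ∀ (u v : Fin p) → u ≢ v →
      2 ≤ weight (colour (colour (λ _ → nothing) u true) v false u) (colour (colour (λ _ → nothing) u true) v false v)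
    weight-first u v u≢v with v ≟ u | v ≟ v
    ... | yes refl | _ = ⊥-elim (u≢v refl)
    ... | no _ | no q = ⊥-elim (q refl)
    ... | no _ | yes _ with u ≟ u
    ...   | yes _ = ≤-refl
    ...   | no q  = ⊥-elim (q refl)

  -- Before the greedy run the ends of edge `i₀` get different colours. That edge then has weight 2
  -- and every other edge at least 1, so the total starts above `n`.
  max-cut : Fin n → ∃ λ (Y : Fin p → Bool) → n < 2 * count (λ i → Y (a i) xor Y (b i))
  max-cut i₀ with colour-all (allFin p) (colour (colour (λ _ → nothing) (a i₀) true) (b i₀) false)
  ... | c′ , le , all = Y , (begin-strict
    n                                   <⟨ sumFin-strict i₀ (λ j → weight-start (a i₀) (b i₀) (a≢b j) (a≢b i₀))
                                             (weight-first (a i₀) (b i₀) (a≢b i₀)) ⟩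
    total (colour (colour (λ _ → nothing) (a i₀) true) (b i₀) false) ≤⟨ le ⟩
    total c′                            ≤⟨ sumFin-mono (λ i → ≤-reflexive (cong₂ weight (Y-spec (a i)) (Y-spec (b i)))) ⟩
    sumFin (λ i → if Y (a i) xor Y (b i) then 2 else 0)      ≡⟨ sumFin-count (λ i → Y (a i) xor Y (b i)) ⟩
    2 * count (λ i → Y (a i) xor Y (b i)) ∎)
    where
    open ≤-Reasoning
    Y : Fin p → Bool
    Y v = proj₁ (all v (inj₁ (∈-allFin v)))
    Y-spec : ∀ v → c′ v ≡ just (Y v)
    Y-spec v = proj₂ (all v (inj₁ (∈-allFin v)))

-- Simple paths, cycles and walks

module _ {p : ℕ} (R : Fin p → Fin p → Set) where

  -- The vertex sequence is an index so that it can serve as `vert` of a `Cycle`.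
  data Path : ∀ {n} → Fin p → Fin p → Vec (Fin p) n → Set where
    stop : ∀ {x} → Path x x (x ∷ [])
    step : ∀ {n x y z} {vs : Vec (Fin p) n} → R x y → All (x ≢_) vs → Path y z vs → Path x z (x ∷ vs)

  path-head : ∀ {n x z} {vs : Vec (Fin p) (suc n)} → Path x z vs → lookup vs zero ≡ x
  path-head stop         = refl
  path-head (step _ _ _) = refl

  path-last : ∀ {n x z} {vs : Vec (Fin p) (suc n)} → Path x z vs → lookup vs (fromℕ n) ≡ z
  path-last stop = refl
  path-last {suc n} (step _ _ q) = path-last q
  path-last {zero} (step _ _ ())

  path-unique : ∀ {n x z} {vs : Vec (Fin p) n} → Path x z vs → Unique vs
  path-unique stop         = [] ∷ []
  path-unique (step _ a q) = a ∷ path-unique q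

  path-step : ∀ {n x z} {vs : Vec (Fin p) (suc n)} → Path x z vs →
    ∀ i → R (lookup vs (inject₁ i)) (lookup vs (suc i))
  path-step {suc n} {x} (step r _ q) zero = subst (R x) (sym (path-head q)) r
  path-step {suc n} (step r _ q) (suc i)  = path-step q i

  -- For `erase-loops`: if prepending `u` would repeat a vertex, the suffix that starts at `u`
  -- replaces the path.
  path-from : ∀ {n y z} {vs : Vec (Fin p) n} u → Path y z vs →
    All (u ≢_) vs ⊎ (∃ λ m → ∃ λ (ws : Vec (Fin p) m) → Path u z ws)
  path-from {y = y} u stop with u ≟ y
  ... | yes refl = inj₂ (_ , _ , stop)
  ... | no u≢y   = inj₁ (u≢y ∷ [])
  path-from {y = y} u (step r a q) with u ≟ y
  ... | yes refl = inj₂ (_ , _ , step r a q)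
  ... | no u≢y with path-from u q
  ...   | inj₁ b = inj₁ (u≢y ∷ b)
  ...   | inj₂ w = inj₂ w

  erase-loops : ∀ {x z} → Star R x z → ∃ λ n → ∃ λ (vs : Vec (Fin p) n) → Path x z vs
  erase-loops ε = _ , _ , stop
  erase-loops {x} (r ◅ w) with erase-loops w
  ... | n , vs , q with path-from x q
  ...   | inj₁ a = _ , _ , step r a q
  ...   | inj₂ s = s

module _ {p : ℕ} {adj : Fin p → Fin p → Bool} {R : Fin p → Fin p → Set}
         (R⇒adj : ∀ {x y} → R x y → adj x y ≡ true) where

  -- Since `x ≢ y` and `¬ R x y`, a simple `R`-path from `x` to `y` has at least three vertices, and
  -- the edge from `y` to `x` closes it.
  path⇒cycle : ∀ {x y} → x ≢ y → ¬ R x y → adj y x ≡ true → Star R x y → Cycle adj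
  path⇒cycle {x} {y} x≢y ¬r yx w with erase-loops R w
  ... | _ , _ , stop = ⊥-elim (x≢y refl)
  ... | _ , _ , step r _ stop = ⊥-elim (¬r r)
  ... | suc (suc (suc n)) , vs , q@(step _ _ (step _ _ _)) = record
    { len   = n
    ; vert  = lookup vs
    ; inj   = lookup-injective (path-unique R q) _ _
    ; steps = λ i → R⇒adj (path-step R q i)
    ; close = trans (cong₂ adj (path-last R q) (path-head R q)) yx
    }
  ... | suc (suc zero) , _ , step _ _ (step _ _ ())

module _ {p : ℕ} {adj : Fin p → Fin p → Bool} (adj-sym : ∀ {x y} → adj x y ≡ true → adj y x ≡ true) where

  walk-snoc : ∀ {l x y z} → WalkLen adj l x y → adj y z ≡ true → WalkLen adj (suc l) x z
  walk-snoc wnil        e = wcons e wnil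
  walk-snoc (wcons f w) e = wcons f (walk-snoc w e)

  walk-reverse : ∀ {l x y} → WalkLen adj l x y → WalkLen adj l y x
  walk-reverse wnil        = wnil
  walk-reverse (wcons e w) = walk-snoc (walk-reverse w) (adj-sym e)

  avoidWalk-snoc : ∀ {v x y z} → AvoidWalk adj v x y → adj y z ≡ true → z ≢ v → AvoidWalk adj v x z
  avoidWalk-snoc (anil p)      e q = acons p e (anil q)
  avoidWalk-snoc (acons p f w) e q = acons p f (avoidWalk-snoc w e q)

  avoidWalk-reverse : ∀ {v x y} → AvoidWalk adj v x y → AvoidWalk adj v y x
  avoidWalk-reverse (anil p)      = anil p
  avoidWalk-reverse (acons p e w) = avoidWalk-snoc (avoidWalk-reverse w) (adj-sym e) p

module _ {p : ℕ} {adj : Fin p → Fin p → Bool} where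

  walk-++ : ∀ {l m x y z} → WalkLen adj l x y → WalkLen adj m y z → WalkLen adj (l + m) x z
  walk-++ wnil        v = v
  walk-++ (wcons e w) v = wcons e (walk-++ w v)

  avoidWalk-++ : ∀ {v x y z} → AvoidWalk adj v x y → AvoidWalk adj v y z → AvoidWalk adj v x z
  avoidWalk-++ (anil _)      w = w
  avoidWalk-++ (acons p e u) w = acons p e (avoidWalk-++ u w)

-- Rooted trees: ancestors and the components of T - v

module RootedTree {p : ℕ} (adj : Fin p → Fin p → Bool) (tree : IsTree adj) (c : Fin p) where

  adj-sym : ∀ {x y} → adj x y ≡ true → adj y x ≡ true
  adj-sym {x} {y} e = trans (sym (proj₁ tree x y)) e

  walk? : ∀ z l x → Dec (WalkLen adj l x z)
  walk? z zero x with x ≟ z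
  ... | yes refl = yes wnil
  ... | no x≢z   = no λ { wnil → x≢z refl }
  walk? z (suc l) x with any? (λ y → (adj x y ≟ᵇ true) ×-dec walk? z l y)
  ... | yes (y , e , w) = yes (wcons e w)
  ... | no none         = no λ { (wcons e w) → none (_ , e , w) }

  abstract
    shortest : ∀ x → ∃ λ l → WalkLen adj l x c × (∀ j → WalkLen adj j x c → l ≤ j)
    shortest x = least (λ l → walk? c l x) _ (proj₂ (proj₁ (proj₂ (proj₂ tree)) x c))

    next : ∀ {l x} → WalkLen adj l x c → Fin p
    next wnil            = c
    next (wcons {y = y} _ _) = y

    dist : Fin p → ℕ
    dist x = proj₁ (shortest x)

    dist≤ : ∀ {l x} → WalkLen adj l x c → dist x ≤ l
    dist≤ {x = x} w = proj₂ (proj₂ (shortest x)) _ w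

    -- The parent of `x`, as the second vertex of a fixed shortest walk to `c`. At the root the
    -- value `c` is a default.
    above : Fin p → Fin p
    above x = next (proj₁ (proj₂ (shortest x)))

    dist≡0 : ∀ {x} → dist x ≡ 0 → x ≡ c
    dist≡0 {x} e with shortest x
    dist≡0 refl | _ , wnil , _ = refl

    par-spec : ∀ {x} → x ≢ c → adj x (above x) ≡ true × dist x ≡ suc (dist (above x))
    par-spec {x} x≢c with shortest x
    ... | _ , wnil , _ = ⊥-elim (x≢c refl)
    ... | suc l , wcons {y = y} e w , min = e ,
      cong suc (≤-antisym (s≤s⁻¹ (min _ (wcons e (proj₁ (proj₂ (shortest y)))))) (dist≤ w))

  dist-root : dist c ≡ 0
  dist-root = n≤0⇒n≡0 (dist≤ wnil)

  dist-par : ∀ {x} → x ≢ c → dist x ≡ suc (dist (above x))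
  dist-par x≢c = proj₂ (par-spec x≢c)

  <-dist⇒≢root : ∀ {d x} → d < dist x → x ≢ c
  <-dist⇒≢root d<x refl = ⊥-elim (<⇒≢ (≤-<-trans z≤n d<x) (sym dist-root))

  ParentEdge : Fin p → Fin p → Set
  ParentEdge x y = (x ≢ c × above x ≡ y) ⊎ (y ≢ c × above y ≡ x)

  parentEdge⇒adj : ∀ {x y} → ParentEdge x y → adj x y ≡ true
  parentEdge⇒adj (inj₁ (x≢c , refl)) = proj₁ (par-spec x≢c)
  parentEdge⇒adj (inj₂ (y≢c , refl)) = adj-sym (proj₁ (par-spec y≢c))

  to-root : ∀ n x → dist x ≤ n → Star ParentEdge x c
  to-root n x le with x ≟ c
  ... | yes refl = ε
  to-root zero x le | no x≢c = ⊥-elim (x≢c (dist≡0 (n≤0⇒n≡0 le)))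
  to-root (suc n) x le | no x≢c =
    inj₁ (x≢c , refl) ◅ to-root n (above x) (s≤s⁻¹ (subst (_≤ suc n) (dist-par x≢c) le))

  -- Here acyclicity enters: any other edge would close the route of parent edges from `x` through
  -- `c` to `y` into a cycle.
  adj⇒parentEdge : ∀ {x y} → adj x y ≡ true → ParentEdge x y
  adj⇒parentEdge {x} {y} e
    with (¬? (x ≟ c) ×-dec (above x ≟ y)) ⊎-dec (¬? (y ≟ c) ×-dec (above y ≟ x))
  ... | yes q = q
  ... | no ¬q = ⊥-elim (proj₂ (proj₂ (proj₂ tree)) (path⇒cycle parentEdge⇒adj x≢y ¬q (adj-sym e)
                  (to-root _ x ≤-refl ◅◅ reverse swap (to-root _ y ≤-refl))))
    where
    x≢y : x ≢ y
    x≢y refl = true≢false (trans (sym e) (proj₁ (proj₂ tree) x))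

  climb : ℕ → Fin p → Fin p
  climb zero    x = x
  climb (suc n) x = climb n (above x)

  -- The ancestor of x at distance d from the root, or x itself when dist x ≤ d.
  anc : ℕ → Fin p → Fin p
  anc d x = climb (dist x ∸ d) x

  anc-self : ∀ {d x} → dist x ≤ d → anc d x ≡ x
  anc-self {d} {x} le = cong (λ n → climb n x) (m≤n⇒m∸n≡0 le)

  dist-par-< : ∀ {d x} → d < dist x → dist x ≡ suc (dist (above x))
  dist-par-< d<x = dist-par (<-dist⇒≢root d<x)

  anc-par : ∀ {d x} → d < dist x → anc d x ≡ anc d (above x)
  anc-par {d} {x} d<x = trans (cong (λ n → climb (n ∸ d) x) (dist-par-< d<x))
    (cong (λ n → climb n x) (+-∸-assoc 1 (s≤s⁻¹ (subst (d <_) (dist-par-< d<x) d<x))))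

  -- Induction along the path towards the root, stopped at distance `d`.
  descend : (P : Fin p → Set) (d : ℕ) → (∀ x → dist x ≤ d → P x) →
    (∀ x → d < dist x → P (above x) → P x) → ∀ x → P x
  descend P d base ind x = go (dist x) x ≤-refl
    where
    go : ∀ n x → dist x ≤ n → P x
    go n x le with dist x ≤? d
    ... | yes q = base x q
    go zero x le | no q = ⊥-elim (q (≤-trans le z≤n))
    go (suc n) x le | no q =
      ind x (≰⇒> q) (go n (above x) (s≤s⁻¹ (subst (_≤ suc n) (dist-par-< (≰⇒> q)) le)))

  dist-anc : ∀ {d} x → d ≤ dist x → dist (anc d x) ≡ d
  dist-anc {d} = descend _ d
    (λ x le ge → trans (cong dist (anc-self le)) (≤-antisym le ge))
    (λ x d<x ih _ → trans (cong dist (anc-par d<x)) (ih (s≤s⁻¹ (subst (d <_) (dist-par-< d<x) d<x))))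

  anc-anc : ∀ {i j} x → i ≤ j → anc i (anc j x) ≡ anc i x
  anc-anc {i} {j} x i≤j = descend (λ x → anc i (anc j x) ≡ anc i x) j
    (λ x le → cong (anc i) (anc-self le))
    (λ x j<x ih → trans (cong (anc i) (anc-par j<x)) (trans ih (sym (anc-par (≤-<-trans i≤j j<x)))))
    x

  anc-root : ∀ x → anc 0 x ≡ c
  anc-root x = dist≡0 (dist-anc x z≤n)

  par-anc : ∀ {d x} → d < dist x → above (anc (suc d) x) ≡ anc d x
  par-anc {d} {x} d<x = begin
    above u          ≡⟨ anc-self (≤-reflexive (ℕₚ.suc-injective (trans (sym (dist-par-< d<u)) du))) ⟨
    anc d (above u)  ≡⟨ anc-par d<u ⟨
    anc d u        ≡⟨ anc-anc x (n≤1+n d) ⟩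
    anc d x        ∎
    where
    open ≡-Reasoning
    u  = anc (suc d) x
    du : dist u ≡ suc d
    du = dist-anc x d<x
    d<u : d < dist u
    d<u = subst (d <_) (sym du) ≤-refl

  -- `u` lies in the subtree rooted at `v`, with `u` equal to `v` allowed.
  Below : Fin p → Fin p → Set
  Below v u = anc (dist v) u ≡ v

  -- Two nodes other than v get the same label iff they lie in the same component of T - v:
  -- v itself is the label of the component containing the root.
  label : Fin p → Fin p → Fin p
  label v u = if does (anc (dist v) u ≟ v) then anc (suc (dist v)) u else v

  label-below : ∀ {v u} → Below v u → label v u ≡ anc (suc (dist v)) u
  label-below {v} {u} b with anc (dist v) u ≟ v
  ... | yes _ = refl
  ... | no q  = ⊥-elim (q b)

  label-not-below : ∀ {v u} → ¬ Below v u → label v u ≡ v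
  label-not-below {v} {u} b with anc (dist v) u ≟ v
  ... | yes q = ⊥-elim (b q)
  ... | no _  = refl

  -- If `x` is no deeper than `v`, neither node lies below `v`. Otherwise both have the same
  -- ancestor at depth `dist v`. If that is `v`, then `above x`, being different from `v`, is
  -- strictly deeper, so the ancestors one level further down agree too.
  label-par : ∀ {v x} → x ≢ c → x ≢ v → above x ≢ v → label v x ≡ label v (above x)
  label-par {v} {x} x≢c x≢v y≢v with dist v <? dist x
  ... | no v≮x = trans (label-not-below ¬x) (sym (label-not-below ¬y))
    where
    x≤v = ≮⇒≥ v≮x
    ¬x : ¬ Below v x
    ¬x b = x≢v (trans (sym (anc-self x≤v)) b)
    ¬y : ¬ Below v (above x)
    ¬y b = y≢v (trans (sym (anc-self (≤-trans (n≤1+n _) (≤-trans (≤-reflexive (sym (dist-par x≢c))) x≤v)))) b)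
  ... | yes v<x with anc (dist v) (above x) ≟ v
  ...   | no ¬b = label-not-below (λ b → ¬b (trans (sym (anc-par v<x)) b))
  ...   | yes b = trans (label-below (trans (anc-par v<x) b)) (anc-par v+1<x)
    where
    v≤y : dist v ≤ dist (above x)
    v≤y = s≤s⁻¹ (subst (dist v <_) (dist-par x≢c) v<x)
    v<y : dist v < dist (above x)
    v<y = ≤∧≢⇒< v≤y (λ e → y≢v (trans (sym (anc-self (≤-reflexive (sym e)))) b))
    v+1<x : suc (dist v) < dist x
    v+1<x = subst (suc (dist v) <_) (sym (dist-par x≢c)) (s≤s v<y)

  label-adj : ∀ {v x y} → x ≢ v → y ≢ v → adj x y ≡ true → label v x ≡ label v y
  label-adj x≢v y≢v e with adj⇒parentEdge e
  ... | inj₁ (x≢c , refl) = label-par x≢c x≢v y≢v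
  ... | inj₂ (y≢c , refl) = sym (label-par y≢c y≢v x≢v)

  avoidWalk-start : ∀ {v x y} → AvoidWalk adj v x y → x ≢ v
  avoidWalk-start (anil q)      = q
  avoidWalk-start (acons q _ _) = q

  -- Consequently a set of edges defined through the labels of their leaves is a union of parts.
  label-avoidWalk : ∀ {v x y} → AvoidWalk adj v x y → label v x ≡ label v y
  label-avoidWalk (anil _)      = refl
  label-avoidWalk (acons q e w) = trans (label-adj q (avoidWalk-start w) e) (label-avoidWalk w)

  child⇒internal : ∀ {u v} → u ≢ c → above u ≡ v → v ≢ c → IsInternal adj v
  child⇒internal {u} {v} u≢c refl v≢c = 2≤count u≢pv (adj-sym (proj₁ (par-spec u≢c))) (proj₁ (par-spec v≢c))
    where
    u≢pv : u ≢ above v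
    u≢pv e = <⇒≢ (<-trans (n<1+n (dist (above v))) (n<1+n _))
      (trans (cong dist (sym e)) (trans (dist-par u≢c) (cong suc (dist-par v≢c))))

  -- The child is the ancestor of `u` one level below `v`; it exists because `v` itself has label
  -- `v`, so that `u` lies strictly below.
  label≢⇒child : ∀ {v u} → label v u ≢ v → Below v u × dist v < dist u ×
    (∃ λ w → w ≢ c × above w ≡ v × dist w ≡ suc (dist v))
  label≢⇒child {v} {u} ne with anc (dist v) u ≟ v
  ... | no _  = ⊥-elim (ne refl)
  ... | yes b with dist v <? dist u
  ...   | no v≮u = ⊥-elim (ne (trans (trans (anc-self (≤-trans (≮⇒≥ v≮u) (n≤1+n _))) (sym (anc-self (≮⇒≥ v≮u)))) b))
  ...   | yes v<u = b , v<u , anc (suc (dist v)) u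
                  , <-dist⇒≢root {0} (subst (0 <_) (sym (dist-anc u v<u)) (s≤s z≤n))
                  , trans (par-anc v<u) b , dist-anc u v<u

module _ {p : ℕ} (adj : Fin p → Fin p → Bool) (tree : IsTree adj) where

  -- A leaf centre can be replaced by its neighbour.
  internal-centre : ∀ {r} → (∃ λ v → IsInternal adj v) → RadiusAtMost adj r →
    ∃ λ c → IsInternal adj c × (∀ x → ∃ λ l → l ≤ r × WalkLen adj l c x)
  internal-centre {r} (v , v-int) (c , reach) with 2 ≤? degree adj c
  ... | yes c-int = c , c-int , reach
  ... | no ¬c-int = move (proj₂ (proj₂ (reach v))) (proj₁ (proj₂ (reach v)))
    where
    open RootedTree adj tree c using (adj-sym)
    only : ∀ {x y} → adj c x ≡ true → adj c y ≡ true → x ≡ y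
    only {x} {y} cx cy with x ≟ y
    ... | yes e = e
    ... | no ne = ⊥-elim (¬c-int (2≤count ne cx cy))
    move : ∀ {l} → WalkLen adj l c v → l ≤ r →
      ∃ λ c → IsInternal adj c × (∀ x → ∃ λ l → l ≤ r × WalkLen adj l c x)
    move wnil _ = ⊥-elim (¬c-int v-int)
    move (wcons {y = d} cd w) l≤r = d , d-int , reach′
      where
      reach′ : ∀ x → ∃ λ l → l ≤ r × WalkLen adj l d x
      reach′ x with reach x
      ... | _ , _ , wnil = 1 , ≤-trans (s≤s z≤n) l≤r , wcons (adj-sym cd) wnil
      -- A walk leaving the leaf `c` passes through `d` first, so its tail starts at `d`.
      ... | suc l , le , wcons ce w = l , ≤-trans (n≤1+n l) le , subst (λ d → WalkLen adj l d x) (only ce cd) w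
      d-int : IsInternal adj d
      d-int with 2 ≤? degree adj d
      ... | yes q = q
      -- If `d` were a leaf too, no walk could leave the pair `c`, `d`, and the internal node `v`
      -- would be out of reach.
      ... | no q  = ⊥-elim (outside w (inj₂ refl))
        where
        only-d : ∀ {y} → adj d y ≡ true → y ≡ c
        only-d {y} dy with y ≟ c
        ... | yes e = e
        ... | no ne = ⊥-elim (q (2≤count ne dy (adj-sym cd)))
        outside : ∀ {l x} → WalkLen adj l x v → x ≡ c ⊎ x ≡ d → ⊥
        outside wnil (inj₁ refl) = ¬c-int v-int
        outside wnil (inj₂ refl) = q v-int
        outside (wcons e w) (inj₁ refl) = outside w (inj₂ (only e cd))
        outside (wcons e w) (inj₂ refl) = outside w (inj₁ (only-d e))

-- Incidence of edges and vertices

Inc : (G : Graph) → Fin (nE G) → Fin (nV G) → Set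
Inc G e x = incident G e x ≡ true

incident₁ : ∀ G e → Inc G e (proj₁ (ends G e))
incident₁ G e = ∨-introˡ (true-does (proj₁ (ends G e) ≟ _) refl)

incident₂ : ∀ G e → Inc G e (proj₂ (ends G e))
incident₂ G e = ∨-introʳ {does (proj₁ (ends G e) ≟ _)} (true-does (proj₂ (ends G e) ≟ _) refl)

incident⇒end : ∀ G {e x} → Inc G e x → proj₁ (ends G e) ≡ x ⊎ proj₂ (ends G e) ≡ x
incident⇒end G i = Sum.map (does-true (_ ≟ _)) (does-true (_ ≟ _)) (∨-true i)

-- The conclusion is the test by which `λG G X` counts `x`.
on-both-sides : ∀ G (X : Fin (nE G) → Bool) e f {x} → Inc G e x → Inc G f x → X e xor X f ≡ true →
  anyFin (λ e → X e ∧ incident G e x) ∧ anyFin (λ e → not (X e) ∧ incident G e x) ≡ true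
on-both-sides G X e f {x} e∋x f∋x d = by-cases (X e) (X f) refl refl d
  where
  meets : (Y : Fin (nE G) → Bool) → ∀ e → Y e ≡ true → Inc G e x → anyFin (λ e → Y e ∧ incident G e x) ≡ true
  meets Y e Ye i = anyFin-intro (λ e → Y e ∧ incident G e x) e (∧-intro Ye i)
  by-cases : ∀ a b → X e ≡ a → X f ≡ b → a xor b ≡ true →
    anyFin (λ e → X e ∧ incident G e x) ∧ anyFin (λ e → not (X e) ∧ incident G e x) ≡ true
  by-cases true false p q _ = ∧-intro (meets X e p e∋x) (meets (λ e → not (X e)) f (cong not q) f∋x)
  by-cases false true p q _ = ∧-intro (meets X f q f∋x) (meets (λ e → not (X e)) e (cong not p) e∋x)

-- Construction of rooted forests

record Ranked (F : RootedForest) (h : ℕ) : Set where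
  field
    rank     : Fin (size F) → ℕ
    rank≥1   : ∀ x → 1 ≤ rank x
    rank≤    : ∀ x → rank x ≤ h
    rank-mono : ∀ {x y} → parent F x ≡ just y → rank y < rank x

  isRootedForest : IsRootedForest F
  isRootedForest x = go (rank x) x ≤-refl
    where
    go : ∀ n x → rank x ≤ n → ∃ λ d → Depth F x d
    go zero x le = ⊥-elim (<-irrefl refl (≤-trans (rank≥1 x) le))
    go (suc n) x le with parent F x in eq
    ... | nothing = 1 , root eq
    ... | just y with go n y (s≤s⁻¹ (≤-trans (rank-mono eq) le))
    ...   | d , δ = suc d , child eq δ

  heightAtMost : HeightAtMost F h
  heightAtMost x d δ = ≤-trans (depth≤rank δ) (rank≤ x)
    where
    depth≤rank : ∀ {x d} → Depth F x d → d ≤ rank x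
    depth≤rank (root _)    = rank≥1 _
    depth≤rank (child e δ) = ≤-trans (s≤s (depth≤rank δ)) (rank-mono e)

-- The nodes are pairs (n , v); the ancestors of (n , v) are the (m , α m v) with m < n.
module LevelForest (N : ℕ) {p : ℕ} (α : ℕ → Fin p → Fin p)
                   (α-α : ∀ {i j} v → i ≤ j → α i (α j v) ≡ α i v) where

  private
    up-level : ∀ {N} → Fin N → Fin p → Maybe (Fin (N * p))
    up-level zero    v = nothing
    up-level (suc n) v = just (combine (inject₁ n) (α (toℕ n) v))

    pair : Fin (N * p) → Fin N × Fin p
    pair = remQuot {N} p

  forest : RootedForest
  forest = record { size = N * p ; parent = λ z → up-level (proj₁ (pair z)) (proj₂ (pair z)) }

  node : Fin N → Fin p → Fin (size forest)
  node = combine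

  node-injective : ∀ {m n u v} → node m u ≡ node n v → m ≡ n × u ≡ v
  node-injective = combine-injective _ _ _ _

  ranked : Ranked forest N
  ranked = record
    { rank      = λ z → suc (toℕ (proj₁ (pair z)))
    ; rank≥1    = λ _ → s≤s z≤n
    ; rank≤     = λ z → toℕ<n (proj₁ (pair z))
    ; rank-mono = λ {z} e → s≤s (lower (proj₁ (pair z)) (proj₂ (pair z)) e)
    }
    where
    lower : ∀ {N} (n : Fin N) v {y} → up-level n v ≡ just y → toℕ (proj₁ (remQuot {N} p y)) < toℕ n
    lower {suc N} (suc n) v refl = s≤s (≤-reflexive
      (trans (cong (λ q → toℕ (proj₁ q)) (remQuot-combine {suc N} {p} (inject₁ n) (α (toℕ n) v))) (toℕ-inject₁ n)))

  private
    parent-node : ∀ n v → parent forest (node n v) ≡ up-level n v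
    parent-node n v = cong (λ q → up-level (proj₁ q) (proj₂ q)) (remQuot-combine n v)

    step-up : ∀ {N} (n : Fin N) (v : Fin p) (m : Fin N) → toℕ m < toℕ n → ∃ λ (n′ : Fin N) →
      toℕ n ≡ suc (toℕ n′) × up-level n v ≡ just (combine n′ (α (toℕ n′) v))
    step-up (suc n) v m _ = inject₁ n , cong suc (sym (toℕ-inject₁ n))
      , cong (λ l → just (combine (inject₁ n) (α l v))) (sym (toℕ-inject₁ n))

  ancestor : ∀ m n v → toℕ m < toℕ n → Anc forest (node m (α (toℕ m) v)) (node n v)
  ancestor m n v = go (toℕ n) n v ≤-refl
    where
    go : ∀ d n v → toℕ n ≤ d → toℕ m < toℕ n → Anc forest (node m (α (toℕ m) v)) (node n v)
    go zero n v le m<n = ⊥-elim (<-irrefl refl (≤-trans (≤-trans (s≤s z≤n) m<n) le))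
    go (suc d) n v le m<n with step-up n v m m<n
    ... | n′ , n≡ , eq with m≤n⇒m<n∨m≡n (s≤s⁻¹ (subst (toℕ m <_) n≡ m<n))
    ...   | inj₁ m<n′ = up (trans (parent-node n v) eq)
              -- By `α-α`, the ancestor at level `m` of the parent is that of `v` itself.
              (subst (λ u → Anc forest (node m u) (node n′ (α (toℕ n′) v))) (α-α v (<⇒≤ m<n′))
                (go d n′ (α (toℕ n′) v) (s≤s⁻¹ (subst (_≤ suc d) n≡ le)) m<n′))
    ...   | inj₂ m≡n′ with toℕ-injective m≡n′
    ...     | refl = par (trans (parent-node n v) eq)

-- The vertices outside P meet at most one edge, so they can be hung as leaves below the others;
-- two such vertices joined by an edge form a component with two vertices.
module Extend (G : Graph) (P : Fin (nV G) → Set) (P? : Decidable P)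
  (pendant : ∀ {x} → ¬ P x → ∀ {e f} → Inc G e x → Inc G f x → e ≡ f)
  (F : RootedForest) {h : ℕ} (R : Ranked F h)
  (φ : ∀ x → P x → Fin (size F)) (φ-inj : ∀ {x y} p q → φ x p ≡ φ y q → x ≡ y)
  (φ-edge : ∀ e p q → proj₁ (ends G e) ≢ proj₂ (ends G e) →
     Anc F (φ (proj₁ (ends G e)) p) (φ (proj₂ (ends G e)) q)
     ⊎ Anc F (φ (proj₂ (ends G e)) q) (φ (proj₁ (ends G e)) p)) where

  open Ranked R
  private
    s = size F
    n = nV G
    end₁ end₂ : Fin (nE G) → Fin n
    end₁ e = proj₁ (ends G e)
    end₂ e = proj₂ (ends G e)

    -- The rule for hanging `x` below `y` along `e`. A first end is hung only below a vertex of `P`,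
    -- so an edge with both ends outside `P` is oriented from its first end to its second. Loops
    -- hang nothing outside `P`.
    Parent : Fin n → Fin n → Fin (nE G) → Set
    Parent x y e = (end₂ e ≡ x × end₁ e ≡ y × y ≢ x) ⊎ (end₁ e ≡ x × end₂ e ≡ y × P y)

    HasParent : Fin n → Set
    HasParent x = ¬ P x × ∃ λ y → ∃ λ e → Parent x y e

    hasParent? : Decidable HasParent
    hasParent? x = ¬? (P? x) ×-dec any? λ y → any? λ e →
      ((end₂ e ≟ x) ×-dec (end₁ e ≟ y) ×-dec ¬? (y ≟ x)) ⊎-dec ((end₁ e ≟ x) ×-dec (end₂ e ≟ y) ×-dec P? y)

    parent-inc : ∀ {x y e} → Parent x y e → Inc G e x
    parent-inc {e = e} (inj₁ (refl , _)) = incident₂ G e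
    parent-inc {e = e} (inj₂ (refl , _)) = incident₁ G e

    parent-inc′ : ∀ {x y e} → Parent x y e → Inc G e y
    parent-inc′ {e = e} (inj₁ (_ , refl , _)) = incident₁ G e
    parent-inc′ {e = e} (inj₂ (_ , refl , _)) = incident₂ G e

    parent-unique : ∀ {x y z e f} → ¬ P x → Parent x y e → Parent x z f → y ≡ z
    parent-unique ¬p q r with pendant ¬p (parent-inc q) (parent-inc r)
    parent-unique ¬p (inj₁ (_ , refl , _)) (inj₁ (_ , refl , _)) | refl = refl
    parent-unique ¬p (inj₂ (_ , refl , _)) (inj₂ (_ , refl , _)) | refl = refl
    parent-unique ¬p (inj₁ (_ , refl , y≢x)) (inj₂ (refl , _)) | refl = ⊥-elim (y≢x refl)
    parent-unique ¬p (inj₂ (refl , _)) (inj₁ (_ , refl , y≢x)) | refl = ⊥-elim (y≢x refl)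

    place : Fin n → Fin (s + n)
    place x with P? x
    ... | yes p = φ x p ↑ˡ n
    ... | no _  = s ↑ʳ x

    place-inj : Injective _≡_ _≡_ place
    place-inj {x} {y} e with P? x | P? y
    ... | yes p | yes q = φ-inj p q (↑ˡ-injective n _ _ e)
    ... | no _  | no _  = ↑ʳ-injective s _ _ e
    ... | yes p | no _  with trans (sym (splitAt-↑ˡ s (φ x p) n)) (trans (cong (splitAt s) e) (splitAt-↑ʳ s n y))
    ...   | ()
    place-inj {x} {y} e | no _ | yes q
      with trans (sym (splitAt-↑ʳ s n x)) (trans (cong (splitAt s) e) (splitAt-↑ˡ s (φ y q) n))
    ...   | ()

    hang : ∀ {x} → Dec (HasParent x) → Maybe (Fin (s + n))
    hang (yes (_ , y , _)) = just (place y)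
    hang (no _)            = nothing

    parent′ : Fin s ⊎ Fin n → Maybe (Fin (s + n))
    parent′ = [ (λ u → Maybe.map (_↑ˡ n) (parent F u)) , (λ x → hang (hasParent? x)) ]′

    F′ : RootedForest
    F′ = record { size = s + n ; parent = λ z → parent′ (splitAt s z) }

    -- One level more than `F` for vertices hung below it, and 2 for a component with two vertices
    -- outside `P`.
    H = (h + 1) ⊔ 2

    rank-hung : ∀ {x} → Dec (HasParent x) → ℕ
    rank-hung (yes _) = H
    rank-hung (no _)  = 1

    rank′ : Fin s ⊎ Fin n → ℕ
    rank′ = [ rank , (λ x → rank-hung (hasParent? x)) ]′

    rank-hung-no : ∀ {x} (d : Dec (HasParent x)) → ¬ HasParent x → rank-hung d ≡ 1
    rank-hung-no (yes q) ¬q = ⊥-elim (¬q q)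
    rank-hung-no (no _)  _  = refl

    h<H : h < H
    h<H = ≤-trans (≤-reflexive (+-comm 1 h)) (m≤m⊔n (h + 1) 2)

    2≤H : 2 ≤ H
    2≤H = m≤n⊔m (h + 1) 2

    -- If `y` is in `P`, its rank is at most `h`. Otherwise its only edge leads to `x` and has `y`
    -- as first end, so `y` is not hung anywhere and has rank 1.
    rank-place : ∀ {x y e} → ¬ P x → Parent x y e → rank′ (splitAt s (place y)) < H
    rank-place {x} {y} ¬p q with P? y
    ... | yes r rewrite splitAt-↑ˡ s (φ y r) n = ≤-<-trans (rank≤ _) h<H
    ... | no ¬r rewrite splitAt-↑ʳ s n y = subst (_< H) (sym (rank-hung-no (hasParent? y) (orphan q))) 2≤H
      where
      orphan : ∀ {e} → Parent x y e → ¬ HasParent y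
      orphan (inj₂ (_ , _ , r)) _ = ¬r r
      orphan q@(inj₁ _) (_ , z , f , w) with pendant ¬r (parent-inc′ q) (parent-inc w)
      orphan (inj₁ (refl , refl , y≢x)) (_ , z , f , inj₁ (e , _)) | refl = y≢x (sym e)
      orphan (inj₁ (refl , refl , _)) (_ , z , f , inj₂ (_ , refl , pz)) | refl = ¬p pz

    rank-mono′ : ∀ a {y} → parent′ a ≡ just y → rank′ (splitAt s y) < rank′ a
    rank-mono′ (inj₁ u) e with parent F u in eq
    rank-mono′ (inj₁ u) refl | just v rewrite splitAt-↑ˡ s v n = rank-mono eq
    rank-mono′ (inj₂ x) e with hasParent? x
    rank-mono′ (inj₂ x) refl | yes (¬p , y , f , q) = rank-place ¬p q

    ranked′ : Ranked F′ H
    ranked′ = record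
      { rank      = λ z → rank′ (splitAt s z)
      ; rank≥1    = λ z → rank≥1′ (splitAt s z)
      ; rank≤     = λ z → rank≤′ (splitAt s z)
      ; rank-mono = λ {z} e → rank-mono′ (splitAt s z) e
      }
      where
      rank≥1′ : ∀ a → 1 ≤ rank′ a
      rank≥1′ (inj₁ u) = rank≥1 u
      rank≥1′ (inj₂ x) with hasParent? x
      ... | yes _ = ≤-trans (s≤s z≤n) 2≤H
      ... | no _  = ≤-refl
      rank≤′ : ∀ a → rank′ a ≤ H
      rank≤′ (inj₁ u) = ≤-trans (rank≤ u) (<⇒≤ h<H)
      rank≤′ (inj₂ x) with hasParent? x
      ... | yes _ = ≤-refl
      ... | no _  = ≤-trans (s≤s z≤n) 2≤H

    anc′ : ∀ {u v} → Anc F u v → Anc F′ (u ↑ˡ n) (v ↑ˡ n)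
    anc′ {u} {v} (par e)  = par (trans (cong parent′ (splitAt-↑ˡ s v n)) (cong (Maybe.map (_↑ˡ n)) e))
    anc′ {u} {v} (up e a) = up (trans (cong parent′ (splitAt-↑ˡ s v n)) (cong (Maybe.map (_↑ˡ n)) e)) (anc′ a)

    hang-spec : ∀ {x y e} → ¬ P x → Parent x y e → (d : Dec (HasParent x)) → hang d ≡ just (place y)
    hang-spec ¬p q (yes (_ , z , f , r)) = cong (λ y → just (place y)) (parent-unique ¬p r q)
    hang-spec ¬p q (no none)             = ⊥-elim (none (¬p , _ , _ , q))

    place-hung : ∀ {x} → ¬ P x → place x ≡ s ↑ʳ x
    place-hung {x} ¬p with P? x
    ... | yes p = ⊥-elim (¬p p)
    ... | no _  = refl

    anc-hung : ∀ {x y e} → ¬ P x → Parent x y e → Anc F′ (place y) (place x)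
    anc-hung {x} {y} ¬p q rewrite place-hung ¬p =
      par (trans (cong parent′ (splitAt-↑ʳ s n x)) (hang-spec ¬p q (hasParent? x)))

    place-edge : ∀ e → end₁ e ≢ end₂ e →
      Anc F′ (place (end₁ e)) (place (end₂ e)) ⊎ Anc F′ (place (end₂ e)) (place (end₁ e))
    place-edge e ne = by-cases (P? (end₁ e)) (P? (end₂ e))
      where
      by-cases : Dec (P (end₁ e)) → Dec (P (end₂ e)) →
        Anc F′ (place (end₁ e)) (place (end₂ e)) ⊎ Anc F′ (place (end₂ e)) (place (end₁ e))
      by-cases _ (no ¬q) = inj₁ (anc-hung {e = e} ¬q (inj₁ (refl , refl , ne)))
      by-cases (no ¬p) (yes q) = inj₂ (anc-hung {e = e} ¬p (inj₂ (refl , refl , q)))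
      by-cases (yes p) (yes q) with P? (end₁ e) | P? (end₂ e)
      ... | no ¬p | _     = ⊥-elim (¬p p)
      ... | yes _ | no ¬q = ⊥-elim (¬q q)
      ... | yes p | yes q = Sum.map anc′ anc′ (φ-edge e p q ne)

  hasForest : HasForestOfHeight G ((h + 1) ⊔ 2)
  hasForest = F′ , Ranked.isRootedForest ranked′ , Ranked.heightAtMost ranked′ , place , place-inj , place-edge

-- From a decomposition to a rooted forest

module FromDecomposition (G : Graph) (D : Decomposition (nE G)) (k : ℕ)
  (width : WidthAtMost (λG G) D (suc k))
  (c : Fin (nodes D)) (c-internal : IsInternal (tadj D) c)
  (reach : ∀ x → ∃ λ l → l ≤ suc k × WalkLen (tadj D) l c x) where

  open RootedTree (tadj D) (isTree D) c

  -- Membership of `x` in `B_v`, with labels in place of walks to make it decidable.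
  Boundary : Fin (nodes D) → Fin (nV G) → Set
  Boundary v x = ∃ λ e → ∃ λ f → Inc G e x × Inc G f x × label v (σ D e) ≢ label v (σ D f)

  boundary? : ∀ v → Decidable (Boundary v)
  boundary? v x = any? λ e → any? λ f →
    (incident G e x ≟ᵇ true) ×-dec (incident G f x ≟ᵇ true) ×-dec ¬? (label v (σ D e) ≟ label v (σ D f))

  boundaryᵇ : Fin (nodes D) → Fin (nV G) → Bool
  boundaryᵇ v x = does (boundary? v x)

  separating : ∀ {v x} → Boundary v x → ∃ λ e → Inc G e x × label v (σ D e) ≢ v
  separating {v} (e , f , e∋x , f∋x , ne) with label v (σ D e) ≟ v
  ... | no q  = e , e∋x , q
  ... | yes q = f , f∋x , λ r → ne (trans q (sym r))

  -- The width bound speaks of internal nodes only. A label other than `v` yields a child of `v`,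
  -- and away from the root there is also a parent.
  boundary-internal : ∀ {v x} → Boundary v x → IsInternal (tadj D) v
  boundary-internal {v} b with v ≟ c
  ... | yes refl = c-internal
  ... | no v≢c with label≢⇒child (proj₂ (proj₂ (separating b)))
  ...   | _ , _ , w , w≢c , pw , _ = child⇒internal w≢c pw v≢c

  dist≤radius : ∀ x → dist x ≤ suc k
  dist≤radius x with reach x
  ... | l , l≤ , w = ≤-trans (dist≤ (walk-reverse adj-sym w)) l≤

  -- A child of `v` is still within the radius, which leaves only `suc k` possible depths for `v`.
  boundary-dist : ∀ {v x} → Boundary v x → dist v < suc k
  boundary-dist b with label≢⇒child (proj₂ (proj₂ (separating b)))
  ... | _ , _ , w , _ , _ , dw = subst (_≤ suc k) dw (dist≤radius w)

  -- Each vertex of `B_v` becomes an edge joining two different labels that it meets. A large cut of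
  -- this auxiliary graph pulls back to a union of parts that separates more than half of `B_v`.
  boundary-count : ∀ {v x} → Boundary v x → count (boundaryᵇ v) < 2 * suc k
  boundary-count {v} {x} b = <-≤-trans (proj₂ cut) (*-monoʳ-≤ 2 (≤-trans cut≤λ
    (width v (boundary-internal b) X (λ e f w → cong Y (label-avoidWalk w)))))
    where
    open Enumeration (enumerate (boundaryᵇ v))
    split : ∀ i → Boundary v (at i)
    split i = does-true (boundary? v (at i)) (sat i)
    left right : Fin (count (boundaryᵇ v)) → Fin (nE G)
    left i  = proj₁ (split i)
    right i = proj₁ (proj₂ (split i))
    cut = max-cut (λ i → label v (σ D (left i))) (λ i → label v (σ D (right i)))
            (λ i → proj₂ (proj₂ (proj₂ (proj₂ (split i)))))
            (proj₁ (onto (true-does (boundary? v x) b)))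
    Y = proj₁ cut
    X : Fin (nE G) → Bool
    X e = Y (label v (σ D e))
    cut≤λ : count (λ i → X (left i) xor X (right i)) ≤ λG G X
    cut≤λ = count-injection (λ i _ → at i) (λ _ _ e → inj e)
      (λ i d → on-both-sides G X (left i) (right i) (proj₁ (proj₂ (proj₂ (split i))))
               (proj₁ (proj₂ (proj₂ (proj₂ (split i))))) d)

  Shared : Fin (nV G) → Set
  Shared x = ∃ λ v → Boundary v x

  shared? : Decidable Shared
  shared? x = any? λ v → boundary? v x

  leaf≢internal : ∀ {e v} → IsInternal (tadj D) v → σ D e ≢ v
  leaf≢internal {e} int refl = <-irrefl refl (≤-trans int (σ-leaf D e))

  -- The neighbour `v` of the leaf of `e` separates this leaf from all other leaves.
  two-edges⇒shared : ∀ {x e f} → e ≢ f → Inc G e x → Inc G f x → Shared x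
  two-edges⇒shared {x} {e} {f} e≢f e∋x f∋x = v , e , f , e∋x , f∋x , λ q → differ (trans (sym q) label-e)
    where
    s≢c : σ D e ≢ c
    s≢c = leaf≢internal c-internal
    v = above (σ D e)
    ds : dist (σ D e) ≡ suc (dist v)
    ds = dist-par s≢c
    v<s : dist v < dist (σ D e)
    v<s = ≤-reflexive (sym ds)
    below-e : Below v (σ D e)
    below-e = trans (anc-par v<s) (anc-self ≤-refl)
    label-e : label v (σ D e) ≡ σ D e
    label-e = trans (label-below below-e) (anc-self (≤-reflexive ds))
    differ : label v (σ D f) ≢ σ D e
    differ q with anc (dist v) (σ D f) ≟ v
    ... | no _ = <⇒≢ v<s (cong dist q)
    ... | yes _ with dist (σ D f) ≤? suc (dist v)
    ...   | yes le = e≢f (σ-inj D (trans (sym q) (anc-self le)))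
    -- Otherwise the leaf of `e` would have a child and be internal.
    ...   | no gt  = leaf≢internal (child⇒internal u≢c (trans (par-anc (≰⇒> gt)) q) s≢c) refl
      where
      u≢c : anc (suc (suc (dist v))) (σ D f) ≢ c
      u≢c = <-dist⇒≢root {0} (subst (0 <_) (sym (dist-anc (σ D f) (≰⇒> gt))) (s≤s z≤n))

  pendant : ∀ {x} → ¬ Shared x → ∀ {e f} → Inc G e x → Inc G f x → e ≡ f
  pendant ¬s {e} {f} e∋x f∋x with e ≟ f
  ... | yes q = q
  ... | no q  = ⊥-elim (¬s (two-edges⇒shared q e∋x f∋x))

  abstract
    top : ∀ {x} → Shared x → ∃ λ v → Boundary v x × (∀ u → Boundary u x → dist v ≤ dist u)
    top {x} s = argmin (λ v → boundary? v x) dist s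

  -- Otherwise the parent of the topmost v would also separate two edges at x.
  top-above : ∀ {x} (s : Shared x) {e} → Inc G e x → Below (proj₁ (top s)) (σ D e)
  top-above {x} s {e} e∋x with top s
  ... | v , b , min with anc (dist v) (σ D e) ≟ v
  ...   | yes q = q
  ...   | no ¬q with v ≟ c
  ...     | yes refl = ⊥-elim (¬q (trans (cong (λ d → anc d (σ D e)) dist-root) (anc-root (σ D e))))
  ...     | no v≢c with separating b
  ...       | f , f∋x , ne with label≢⇒child ne
  ...         | below-f , _ = ⊥-elim (<-irrefl refl (≤-trans (≤-reflexive (sym dv))
                                (min (above v) (f , e , f∋x , e∋x , λ q → differ (trans (sym q) label-f)))))
    where
    dv : dist v ≡ suc (dist (above v))
    dv = dist-par v≢c
    u<v : dist (above v) < dist v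
    u<v = ≤-reflexive (sym dv)
    anc-v : anc (dist (above v)) v ≡ above v
    anc-v = trans (anc-par u<v) (anc-self ≤-refl)
    label-f : label (above v) (σ D f) ≡ v
    label-f = trans (label-below (trans (sym (anc-anc (σ D f) (<⇒≤ u<v)))
                (trans (cong (anc (dist (above v))) below-f) anc-v)))
              (trans (cong (λ d → anc d (σ D f)) (sym dv)) below-f)
    differ : label (above v) (σ D e) ≢ v
    differ q with anc (dist (above v)) (σ D e) ≟ above v
    ... | no _  = <⇒≢ u<v (cong dist q)
    ... | yes _ = ¬q (trans (cong (λ d → anc d (σ D e)) dv) q)

  -- The largest size of `B_v` that `boundary-count` permits.
  w : ℕ
  w = suc (2 * k)

  rank : ∀ {x} (s : Shared x) → ∃ λ (i : Fin (count (boundaryᵇ (proj₁ (top s))))) →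
    Enumeration.at (enumerate (boundaryᵇ (proj₁ (top s)))) i ≡ x
  rank {x} s = Enumeration.onto (enumerate (boundaryᵇ (proj₁ (top s))))
    (true-does (boundary? (proj₁ (top s)) x) (proj₁ (proj₂ (top s))))

  index : ∀ {x} → Shared x → ℕ
  index s = toℕ (proj₁ (rank s))

  index<w : ∀ {x} (s : Shared x) → index s < w
  index<w s = <-≤-trans (toℕ<n (proj₁ (rank s)))
    (s≤s⁻¹ (≤-trans (boundary-count (proj₁ (proj₂ (top s)))) (≤-reflexive (2*suc k))))
    where
    2*suc : ∀ k → 2 * suc k ≡ suc (suc (2 * k))
    2*suc = solve-∀

  -- A two-digit number in base `w`: the depth of the topmost node, then the index of `x` in its
  -- boundary. Division by `w` recovers the depth.
  level : ∀ {x} → Shared x → ℕ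
  level s = index s + dist (proj₁ (top s)) * w

  level< : ∀ {x} (s : Shared x) → level s < suc k * w
  level< s = <-≤-trans (+-monoˡ-< _ (index<w s)) (*-monoˡ-≤ w (boundary-dist (proj₁ (proj₂ (top s)))))

  level/w : ∀ {x} (s : Shared x) → level s / w ≡ dist (proj₁ (top s))
  level/w s = trans (+-distrib-/-∣ʳ (index s) (n∣m*n (dist (proj₁ (top s)))))
    (cong₂ _+_ (m<n⇒m/n≡0 (index<w s)) (m*n/n≡m (dist (proj₁ (top s))) w))

  same-position : ∀ {x y} (s : Shared x) (r : Shared y) →
    proj₁ (top s) ≡ proj₁ (top r) → level s ≡ level r → x ≡ y
  same-position s r t≡ l≡ = same (proj₁ (top s)) (proj₁ (top r)) t≡ (rank s) (rank r)
    (+-cancelʳ-≡ (dist (proj₁ (top s)) * w) (index s) (index r) (trans l≡ (cong (λ v → index r + dist v * w) (sym t≡))))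
    where
    same : ∀ u v → u ≡ v → ∀ {x y} (i : ∃ λ i → Enumeration.at (enumerate (boundaryᵇ u)) i ≡ x)
      (j : ∃ λ i → Enumeration.at (enumerate (boundaryᵇ v)) i ≡ y) → toℕ (proj₁ i) ≡ toℕ (proj₁ j) → x ≡ y
    same u .u refl (i , refl) (j , refl) e = cong (Enumeration.at (enumerate (boundaryᵇ u))) (toℕ-injective e)

  -- Levels `d * w` to `d * w + 2 * k` form the chain for depth `d`, and the ancestor map is
  -- constant on each such block.
  open LevelForest (suc k * w) (λ n v → anc (n / w) v) (λ {i} {j} v i≤j → anc-anc {i / w} {j / w} v (/-monoˡ-≤ w i≤j))

  levelᶠ : ∀ {x} → Shared x → Fin (suc k * w)
  levelᶠ s = fromℕ< (level< s)

  φ : ∀ x → Shared x → Fin (size forest)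
  φ x s = node (levelᶠ s) (proj₁ (top s))

  φ-inj : ∀ {x y} (s : Shared x) (r : Shared y) → φ x s ≡ φ y r → x ≡ y
  φ-inj s r e = same-position s r (proj₂ same-node)
    (trans (sym (toℕ-fromℕ< (level< s))) (trans (cong toℕ (proj₁ same-node)) (toℕ-fromℕ< (level< r))))
    where
    same-node : levelᶠ s ≡ levelᶠ r × proj₁ (top s) ≡ proj₁ (top r)
    same-node = node-injective e

  -- The smaller level makes `t` no deeper than `u`. Both are ancestors of the leaf of `e`, so `t`
  -- is the ancestor of `u` at its depth.
  φ-ancestor : ∀ {x y} (s : Shared x) (r : Shared y) {e} → Inc G e x → Inc G e y → level s < level r →
    Anc forest (φ x s) (φ y r)
  φ-ancestor {x} {y} s r {e} ix iy lt =
    subst (λ u → Anc forest (node (levelᶠ s) u) (φ y r)) anc≡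
      (ancestor (levelᶠ s) (levelᶠ r) (proj₁ (top r))
        (subst₂ _<_ (sym (toℕ-fromℕ< (level< s))) (sym (toℕ-fromℕ< (level< r))) lt))
    where
    t = proj₁ (top s)
    u = proj₁ (top r)
    t≤u : dist t ≤ dist u
    t≤u = subst₂ _≤_ (level/w s) (level/w r) (/-monoˡ-≤ w (<⇒≤ lt))
    open ≡-Reasoning
    anc≡ : anc (toℕ (levelᶠ s) / w) u ≡ t
    anc≡ = begin
      anc (toℕ (levelᶠ s) / w) u       ≡⟨ cong (λ l → anc (l / w) u) (toℕ-fromℕ< (level< s)) ⟩
      anc (level s / w) u              ≡⟨ cong (λ d → anc d u) (level/w s) ⟩
      anc (dist t) u                   ≡⟨ cong (anc (dist t)) (top-above r iy) ⟨
      anc (dist t) (anc (dist u) (σ D e)) ≡⟨ anc-anc (σ D e) t≤u ⟩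
      anc (dist t) (σ D e)             ≡⟨ top-above s ix ⟩
      t                                ∎

  φ-edge : ∀ e s r → proj₁ (ends G e) ≢ proj₂ (ends G e) →
     Anc forest (φ (proj₁ (ends G e)) s) (φ (proj₂ (ends G e)) r)
     ⊎ Anc forest (φ (proj₂ (ends G e)) r) (φ (proj₁ (ends G e)) s)
  φ-edge e s r ne = by-cases (<-cmp (level s) (level r))
    where
    -- Equal levels give equal depths, and the leaf of `e` has only one ancestor at each depth.
    t≡ : level s ≡ level r → proj₁ (top s) ≡ proj₁ (top r)
    t≡ l≡ = trans (sym (top-above s (incident₁ G e)))
      (trans (cong (λ d → anc d (σ D e)) (trans (sym (level/w s)) (trans (cong (_/ w) l≡) (level/w r))))
        (top-above r (incident₂ G e)))
    by-cases : Tri (level s < level r) (level s ≡ level r) (level r < level s) →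
      Anc forest (φ (proj₁ (ends G e)) s) (φ (proj₂ (ends G e)) r)
      ⊎ Anc forest (φ (proj₂ (ends G e)) r) (φ (proj₁ (ends G e)) s)
    by-cases (tri< lt _ _) = inj₁ (φ-ancestor s r (incident₁ G e) (incident₂ G e) lt)
    by-cases (tri> _ _ gt) = inj₂ (φ-ancestor r s (incident₂ G e) (incident₁ G e) gt)
    by-cases (tri≈ _ l≡ _) = ⊥-elim (ne (same-position s r (t≡ l≡) l≡))

  hasForest : HasForestOfHeight G ((suc k * w + 1) ⊔ 2)
  hasForest = Extend.hasForest G Shared shared? pendant forest ranked φ φ-inj φ-edge

-- `Extend` on the empty forest with `P` empty: any two edges coincide, so each vertex meets at most
-- one.
few-edges⇒hasForest : ∀ G → nE G < 2 → HasForestOfHeight G 2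
few-edges⇒hasForest G m<2 = Extend.hasForest G (λ _ → ⊥) (λ _ → no λ ()) (λ _ _ _ → unique m<2 _ _)
  (record { size = 0 ; parent = λ () }) {h = 0}
  (record { rank = λ () ; rank≥1 = λ () ; rank≤ = λ () ; rank-mono = λ { {()} } })
  (λ _ ()) (λ ()) (λ _ ())
  where
  unique : ∀ {m} → m < 2 → (e f : Fin m) → e ≡ f
  unique {suc zero} _ zero zero = refl
  unique {suc (suc m)} (s≤s (s≤s ()))

decomposition⇒hasForest : ∀ G k → HasDecomposition (λG G) k k → HasForestOfHeight G ((2 * k * k ∸ k + 1) ⊔ 2)
decomposition⇒hasForest G k (D , width , radius) with internal-centre (tadj D) (isTree D) (hasInternal D) radius
decomposition⇒hasForest G zero (D , width , radius) | c , c-int , reach with radius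
-- Radius 0 leaves a single node, which cannot be internal.
... | c′ , reach′ = ⊥-elim (<-irrefl refl (≤-trans c-int (count≤1 (λ x y _ _ → trans (sym (all≡ x)) (all≡ y)))))
  where
  all≡ : ∀ x → c′ ≡ x
  all≡ x with reach′ x
  ... | zero , _ , wnil = refl
decomposition⇒hasForest G (suc k) (D , width , radius) | c , c-int , reach =
  -- The forest has `suc k` blocks of `2 * k + 1` levels each.
  subst (λ n → HasForestOfHeight G ((n + 1) ⊔ 2))
    (sym (trans (cong (_∸ suc k) (arith k)) (m+n∸n≡m (suc k * suc (2 * k)) (suc k))))
    (FromDecomposition.hasForest G D k width c c-int reach)
  where
  arith : ∀ k → 2 * suc k * suc k ≡ suc k * suc (2 * k) + suc k
  arith = solve-∀

-- Trees given by parent pointers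

argmax : ∀ {n} (f : Fin (suc n) → ℕ) → ∃ λ i → ∀ j → f j ≤ f i
argmax {zero}  f = zero , λ { zero → ≤-refl }
argmax {suc n} f with argmax (λ i → f (suc i))
... | i , max with ≤-total (f zero) (f (suc i))
...   | inj₁ le = suc i , λ { zero → le ; (suc j) → max j }
...   | inj₂ ge = zero , λ { zero → ≤-refl ; (suc j) → ≤-trans (max j) ge }

last-or-inject₁ : ∀ {n} (i : Fin (suc n)) → i ≡ fromℕ n ⊎ ∃ λ j → i ≡ inject₁ j
last-or-inject₁ {zero}  zero    = inj₁ refl
last-or-inject₁ {suc n} zero    = inj₂ (zero , refl)
last-or-inject₁ {suc n} (suc i) with last-or-inject₁ i
... | inj₁ refl       = inj₁ refl
... | inj₂ (j , refl) = inj₂ (suc j , refl)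

-- Argument order: Ancestors parent x y says that y is reached from x by following parents.
Ancestors : ∀ {n} → (Fin n → Maybe (Fin n)) → Fin n → Fin n → Set
Ancestors parent = Star (λ x y → parent x ≡ just y)

ancestors-last : ∀ {n} {parent : Fin n → Maybe (Fin n)} {x y} → Ancestors parent x y → x ≢ y →
  ∃ λ z → parent z ≡ just y
ancestors-last ε ne = ⊥-elim (ne refl)
ancestors-last {y = y} (_◅_ {j = z} e w) _ with z ≟ y
... | yes refl = _ , e
... | no z≢y   = ancestors-last w z≢y

module ParentTree {p : ℕ} (parent : Fin p → Maybe (Fin p)) (r : Fin p)
  (orphan⇒root : ∀ {x} → parent x ≡ nothing → x ≡ r)
  (rank : Fin p → ℕ) (rank-mono : ∀ {x y} → parent x ≡ just y → rank y < rank x) where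

  isParent : Fin p → Fin p → Bool
  isParent x y = does (≡-dec _≟_ (parent x) (just y))

  adj : Fin p → Fin p → Bool
  adj x y = isParent x y ∨ isParent y x

  adj-cases : ∀ {x y} → adj x y ≡ true → parent x ≡ just y ⊎ parent y ≡ just x
  adj-cases {x} {y} e =
    Sum.map (does-true (≡-dec _≟_ (parent x) (just y))) (does-true (≡-dec _≟_ (parent y) (just x))) (∨-true e)

  adj-parent : ∀ {x y} → parent x ≡ just y → adj x y ≡ true
  adj-parent {x} {y} e = ∨-introˡ (true-does (≡-dec _≟_ (parent x) (just y)) e)

  adj-comm : ∀ x y → adj x y ≡ adj y x
  adj-comm x y = ∨-comm (isParent x y) (isParent y x)

  adj-sym : ∀ {x y} → adj x y ≡ true → adj y x ≡ true
  adj-sym {x} {y} = trans (adj-comm y x)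

  child-adj : ∀ {x y} → parent x ≡ just y → adj y x ≡ true
  child-adj {x} {y} e = adj-sym {x} {y} (adj-parent e)

  reverse-walk : ∀ {l x y} → WalkLen adj l x y → WalkLen adj l y x
  reverse-walk = walk-reverse (λ {x} {y} → adj-sym {x} {y})

  reverse-avoiding : ∀ {v x y} → AvoidWalk adj v x y → AvoidWalk adj v y x
  reverse-avoiding = avoidWalk-reverse (λ {x} {y} → adj-sym {x} {y})

  adj-irrefl : ∀ x → adj x x ≡ false
  adj-irrefl x = ¬-not (λ e → [ loop , loop ]′ (adj-cases {x} {x} e))
    where
    loop : parent x ≢ just x
    loop e = <-irrefl refl (rank-mono e)

  ancestors-root : ∀ x → Ancestors parent x r × ∃ λ l → l ≤ rank x × WalkLen adj l x r
  ancestors-root x = go (rank x) x ≤-refl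
    where
    go : ∀ n x → rank x ≤ n → Ancestors parent x r × ∃ λ l → l ≤ rank x × WalkLen adj l x r
    go n x le with parent x in eq
    ... | nothing with orphan⇒root eq
    ...   | refl = ε , 0 , z≤n , wnil
    go zero x le | just y = ⊥-elim (<-irrefl refl (≤-trans (≤-trans (s≤s z≤n) (rank-mono eq)) le))
    go (suc n) x le | just y with go n y (s≤s⁻¹ (≤-trans (rank-mono eq) le))
    ... | a , l , l≤ , w = eq ◅ a , suc l , ≤-trans (s≤s l≤) (rank-mono eq) , wcons (adj-parent eq) w

  connected : Connected adj
  connected x y with ancestors-root x | ancestors-root y
  ... | _ , _ , _ , v | _ , _ , _ , w = _ , walk-++ v (reverse-walk w)

  radius : ∀ {h} → (∀ x → rank x ≤ h) → RadiusAtMost adj h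
  radius rank≤h = r , λ x → let _ , l , l≤ , w = ancestors-root x in l , ≤-trans l≤ (rank≤h x) , reverse-walk w

  -- A vertex of maximal rank on a cycle would have both its neighbours as parents.
  acyclic : ¬ Cycle adj
  acyclic C = contradiction (neighbours i)
    where
    open Cycle C
    i = proj₁ (argmax (λ j → rank (vert j)))
    Neighbours : Fin (3 + len) → Set
    Neighbours j = ∃ λ a → ∃ λ b → a ≢ b × adj (vert j) (vert a) ≡ true × adj (vert j) (vert b) ≡ true
    neighbours : ∀ j → Neighbours j
    -- A `Cycle` is a path with one closing edge, so its two end positions are treated apart. Length
    -- at least three keeps the two neighbours distinct.
    neighbours zero = suc zero , fromℕ (2 + len) , (λ ()) , steps zero , adj-sym {vert (fromℕ (2 + len))} {vert zero} close
    neighbours (suc j) with last-or-inject₁ (suc j)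
    ... | inj₁ refl = zero , inject₁ j , (λ ()) , close , adj-sym {vert (inject₁ j)} {vert (suc j)} (steps j)
    ... | inj₂ (j′ , e) = inject₁ j , suc j′ , apart , adj-sym {vert (inject₁ j)} {vert (suc j)} (steps j)
      , trans (cong (λ k → adj (vert k) (vert (suc j′))) e) (steps j′)
      where
      apart : inject₁ j ≢ suc j′
      apart q = <⇒≢ (≤-trans (n<1+n (toℕ j)) (n≤1+n _))
        (trans (trans (sym (toℕ-inject₁ j)) (cong toℕ q)) (cong suc (sym (trans (cong toℕ e) (toℕ-inject₁ j′)))))
    is-parent : ∀ {a} → adj (vert i) (vert a) ≡ true → parent (vert i) ≡ just (vert a)
    is-parent {a} e with adj-cases {vert i} {vert a} e
    ... | inj₁ q = q
    ... | inj₂ q = ⊥-elim (<-irrefl refl (≤-trans (rank-mono q) (proj₂ (argmax (λ j → rank (vert j))) a)))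
    contradiction : Neighbours i → ⊥
    contradiction (a , b , a≢b , ea , eb) =
      a≢b (inj (just-injective (trans (sym (is-parent ea)) (is-parent eb))))

  isTree′ : IsTree adj
  isTree′ = adj-comm , adj-irrefl , connected , acyclic

  childless⇒leaf : ∀ {x} → (∀ y → parent y ≢ just x) → IsLeaf adj x
  childless⇒leaf {x} none = count≤1 λ y z ey ez → just-injective (trans (sym (is-parent ey)) (is-parent ez))
    where
    is-parent : ∀ {y} → adj x y ≡ true → parent x ≡ just y
    is-parent {y} e with adj-cases {x} {y} e
    ... | inj₁ q = q
    ... | inj₂ q = ⊥-elim (none _ q)

  parent-and-child⇒internal : ∀ {x y z} → parent x ≡ just y → parent z ≡ just x → IsInternal adj x
  parent-and-child⇒internal px pz =
    2≤count {f = adj _} (λ { refl → <-irrefl refl (<-trans (rank-mono px) (rank-mono pz)) })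
      (adj-parent px) (child-adj pz)

  two-children⇒internal : ∀ {x y z} → y ≢ z → parent y ≡ just x → parent z ≡ just x → IsInternal adj x
  two-children⇒internal y≢z py pz = 2≤count {f = adj _} y≢z (child-adj py) (child-adj pz)

  -- The walk is the parent path; `between` says that `v` is not on it.
  avoid-up : ∀ {v x y} → Ancestors parent x y → (Ancestors parent x v → Ancestors parent v y → ⊥) → AvoidWalk adj v x y
  avoid-up {x = x} ε between = anil λ { refl → between ε ε }
  avoid-up (e ◅ w) between =
    acons (λ { refl → between ε (e ◅ w) }) (adj-parent e) (avoid-up w (λ a b → between (e ◅ a) b))

-- Depths and ancestors in a rooted forest

module _ {F : RootedForest} where

  depth-unique : ∀ {x d d′} → Depth F x d → Depth F x d′ → d ≡ d′
  depth-unique (root _)    (root _)    = refl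
  depth-unique (root p)    (child q _) with trans (sym p) q
  ... | ()
  depth-unique (child p _) (root q) with trans (sym p) q
  ... | ()
  depth-unique (child p δ) (child q η) with trans (sym p) q
  ... | refl = cong suc (depth-unique δ η)

  depth≥1 : ∀ {x d} → Depth F x d → 1 ≤ d
  depth≥1 (root _)    = s≤s z≤n
  depth≥1 (child _ _) = s≤s z≤n

  anc⇒ancestors : ∀ {x y} → Anc F x y → Ancestors (parent F) y x
  anc⇒ancestors (par e)  = e ◅ ε
  anc⇒ancestors (up e a) = e ◅ anc⇒ancestors a

  -- `x` and its ancestors as a list, used both to decide ancestry and to count.
  chain : ∀ {x d} → Depth F x d → List (Fin (size F))
  chain {x} (root _)    = x ∷ []
  chain {x} (child _ δ) = x ∷ chain δ

  length-chain : ∀ {x d} (δ : Depth F x d) → length (chain δ) ≡ d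
  length-chain (root _)    = refl
  length-chain (child _ δ) = cong suc (length-chain δ)

  chain-complete : ∀ {x d u} (δ : Depth F x d) → Ancestors (parent F) x u → u ∈ chain δ
  chain-complete (root _)    ε = here refl
  chain-complete (child _ _) ε = here refl
  chain-complete (root p) (q ◅ _) with trans (sym p) q
  ... | ()
  chain-complete (child p δ) (q ◅ a) with trans (sym p) q
  ... | refl = there (chain-complete δ a)

  chain-sound : ∀ {x d u} (δ : Depth F x d) → u ∈ chain δ → Ancestors (parent F) x u
  chain-sound (root _)    (here refl) = ε
  chain-sound (child _ _) (here refl) = ε
  chain-sound (child p δ) (there m)   = p ◅ chain-sound δ m

  ancestors? : IsRootedForest F → ∀ x u → Dec (Ancestors (parent F) x u)
  ancestors? rf x u with DecMembership._∈?_ _≟_ u (chain (proj₂ (rf x)))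
  ... | yes m = yes (chain-sound (proj₂ (rf x)) m)
  ... | no ¬m = no λ a → ¬m (chain-complete (proj₂ (rf x)) a)

  count-ancestors : ∀ {n x d} {f : Fin n → Bool} (δ : Depth F x d) {φ : Fin n → Fin (size F)} → Injective _≡_ _≡_ φ →
    (∀ y → f y ≡ true → Ancestors (parent F) x (φ y)) → count f ≤ d
  count-ancestors {f = f} δ {φ} φ-inj above = subst (count f ≤_) (length-chain δ)
    (count≤ (λ y p → Any.index (member y p)) λ {y} {z} p q e →
      φ-inj (trans (lookup-index (member y p)) (trans (cong (List.lookup (chain δ)) e) (sym (lookup-index (member z q))))))
    where
    member : ∀ y → f y ≡ true → φ y ∈ chain δ
    member y p = chain-complete δ (above y p)

-- From a rooted forest to a decomposition

module FromForest (G : Graph) {t : ℕ} (F : RootedForest) (rooted : IsRootedForest F) (height : HeightAtMost F t)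
  (closure : ClosureContains F G) (e₀ e₁ : Fin (nE G)) (e₁≢e₀ : e₁ ≢ e₀) where

  private
    s = size F
    m = nE G
    φ = proj₁ closure

    _⊑_ : Fin s → Fin s → Set
    u ⊑ x = Ancestors (parent F) x u

    _⊑?_ : ∀ u x → Dec (u ⊑ x)
    u ⊑? x = ancestors? rooted x u

    -- A loop goes to its vertex, any other edge to the lower of its two ends, which are comparable
    -- in `F`.
    attach : ∀ e → ∃ λ u → ∀ x → Inc G e x → φ x ⊑ u
    attach e with proj₁ (ends G e) ≟ proj₂ (ends G e)
    ... | yes q = φ (proj₁ (ends G e)) , λ x i → both x (incident⇒end G i)
      where
      both : ∀ x → proj₁ (ends G e) ≡ x ⊎ proj₂ (ends G e) ≡ x → φ x ⊑ φ (proj₁ (ends G e))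
      both x (inj₁ refl) = ε
      both x (inj₂ r)    = subst (λ y → φ y ⊑ φ (proj₁ (ends G e))) (trans q r) ε
    ... | no ne with proj₂ (proj₂ closure) e ne
    ...   | inj₁ a = φ (proj₂ (ends G e)) , λ x i → both x (incident⇒end G i)
      where
      both : ∀ x → proj₁ (ends G e) ≡ x ⊎ proj₂ (ends G e) ≡ x → φ x ⊑ φ (proj₂ (ends G e))
      both x (inj₁ refl) = anc⇒ancestors a
      both x (inj₂ refl) = ε
    ...   | inj₂ a = φ (proj₁ (ends G e)) , λ x i → both x (incident⇒end G i)
      where
      both : ∀ x → proj₁ (ends G e) ≡ x ⊎ proj₂ (ends G e) ≡ x → φ x ⊑ φ (proj₁ (ends G e))
      both x (inj₁ refl) = ε
      both x (inj₂ refl) = anc⇒ancestors a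

    att : Fin m → Fin s
    att e = proj₁ (attach e)

    -- The pruning criterion: a kept vertex has a leaf below it, so it cannot itself become a leaf.
    -- The edge `e₀` does not count because it moves to the new root.
    Used : Fin s → Set
    Used u = ∃ λ e → e ≢ e₀ × u ⊑ att e

    used? : Decidable Used
    used? u = any? λ e → ¬? (e ≟ e₀) ×-dec (u ⊑? att e)

    usedᵇ : Fin s → Bool
    usedᵇ u = does (used? u)

    open Enumeration (enumerate usedᵇ)
    q = count usedᵇ

    at-used : ∀ i → Used (at i)
    at-used i = does-true (used? (at i)) (sat i)

    -- The new root, then the kept vertices of `F`, then one leaf for each edge of `G`.
    Node : Set
    Node = Fin (suc (q + m))

    inner : Fin q → Node
    inner i = suc (i ↑ˡ m)

    leaf : Fin m → Node
    leaf e = suc (q ↑ʳ e)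

    data View : Node → Set where
      isRoot  : View zero
      isInner : ∀ i → View (inner i)
      isLeaf  : ∀ e → View (leaf e)

    view : ∀ z → View z
    view zero = isRoot
    view (suc z) = subst (λ z → View (suc z)) (join-splitAt q m z) (from (splitAt q z))
      where
      from : ∀ a → View (suc (join q m a))
      from (inj₁ i) = isInner i
      from (inj₂ e) = isLeaf e

    inner-injective : ∀ {i j} → inner i ≡ inner j → i ≡ j
    inner-injective r = ↑ˡ-injective m _ _ (suc-injective r)

    leaf-injective : ∀ {e f} → leaf e ≡ leaf f → e ≡ f
    leaf-injective r = ↑ʳ-injective q _ _ (suc-injective r)

    inner≢leaf : ∀ {i e} → inner i ≢ leaf e
    inner≢leaf {i} {e} r
      with trans (sym (splitAt-↑ˡ q i m)) (trans (cong (splitAt q) (suc-injective r)) (splitAt-↑ʳ q m e))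
    ... | ()

    place : ∀ {u} → Dec (Used u) → Node
    place {u} (yes p) = inner (proj₁ (onto (true-does (used? u) p)))
    place (no _)      = zero

    -- The value `zero` at pruned vertices is a default: parents of kept vertices are kept, and so
    -- is `att e` for `e ≢ e₀`.
    locate : Fin s → Node
    locate u = place (used? u)

    place-cases : ∀ {u} (d : Dec (Used u)) → place d ≡ zero ⊎ ∃ λ i → place d ≡ inner i × at i ≡ u
    place-cases {u} (yes p) = inj₂ (_ , refl , proj₂ (onto (true-does (used? u) p)))
    place-cases (no _)      = inj₁ refl

    locate-cases : ∀ u → locate u ≡ zero ⊎ ∃ λ i → locate u ≡ inner i × at i ≡ u
    locate-cases u = place-cases (used? u)

    locate-at : ∀ i → locate (at i) ≡ inner i
    locate-at i = go (used? (at i))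
      where
      go : (d : Dec (Used (at i))) → place d ≡ inner i
      go (yes p) = cong inner (inj (proj₂ (onto (true-does (used? (at i)) p))))
      go (no ¬p) = ⊥-elim (¬p (at-used i))

    locate-used : ∀ {u} → Used u → ∃ λ i → locate u ≡ inner i × at i ≡ u
    locate-used {u} p with onto (true-does (used? u) p)
    ... | i , refl = i , locate-at i , refl

    locate≢leaf : ∀ u {e} → locate u ≢ leaf e
    locate≢leaf u r with locate-cases u
    ... | inj₁ l = 0≢suc (trans (sym l) r)
      where
      0≢suc : ∀ {n} {i : Fin n} → _≢_ {A = Fin (suc n)} zero (suc i)
      0≢suc ()
    ... | inj₂ (i , l , _) = inner≢leaf (trans (sym l) r)

    above-inner : Fin q → Node
    above-inner i = maybe′ locate zero (parent F (at i))

    above-leaf : ∀ e → Dec (e ≡ e₀) → Node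
    above-leaf e (yes _) = zero
    above-leaf e (no _)  = locate (att e)

    parentᵀ : Node → Maybe Node
    parentᵀ zero    = nothing
    parentᵀ (suc z) = just ([ above-inner , (λ e → above-leaf e (e ≟ e₀)) ]′ (splitAt q z))

    parent-inner : ∀ i → parentᵀ (inner i) ≡ just (above-inner i)
    parent-inner i rewrite splitAt-↑ˡ q i m = refl

    parent-inner-up : ∀ i {y} → parent F (at i) ≡ just y → parentᵀ (inner i) ≡ just (locate y)
    parent-inner-up i e = trans (parent-inner i) (cong (λ y → just (maybe′ locate zero y)) e)

    parent-leaf : ∀ e → parentᵀ (leaf e) ≡ just (above-leaf e (e ≟ e₀))
    parent-leaf e rewrite splitAt-↑ʳ q m e = refl

    parent-e₀ : parentᵀ (leaf e₀) ≡ just zero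
    parent-e₀ = trans (parent-leaf e₀) (cong just (go (e₀ ≟ e₀)))
      where
      go : (d : Dec (e₀ ≡ e₀)) → above-leaf e₀ d ≡ zero
      go (yes _) = refl
      go (no ne) = ⊥-elim (ne refl)

    parent-other : ∀ {e} → e ≢ e₀ → parentᵀ (leaf e) ≡ just (locate (att e))
    parent-other {e} ne = trans (parent-leaf e) (cong just (go (e ≟ e₀)))
      where
      go : (d : Dec (e ≡ e₀)) → above-leaf e d ≡ locate (att e)
      go (yes r) = ⊥-elim (ne r)
      go (no _)  = refl

    depth : Fin s → ℕ
    depth u = proj₁ (rooted u)

    -- Leaves rank above every depth in `F`, so the radius is at most `suc t`.
    rankᵃ : Fin q ⊎ Fin m → ℕ
    rankᵃ = [ (λ i → depth (at i)) , (λ _ → suc t) ]′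

    rank : Node → ℕ
    rank zero    = 0
    rank (suc z) = rankᵃ (splitAt q z)

    rank-inner : ∀ i → rank (inner i) ≡ depth (at i)
    rank-inner i = cong rankᵃ (splitAt-↑ˡ q i m)

    depth≤t : ∀ u → depth u ≤ t
    depth≤t u = height u _ (proj₂ (rooted u))

    rank-locate : ∀ u → rank (locate u) ≤ depth u
    rank-locate u with locate-cases u
    ... | inj₁ l = subst (λ z → rank z ≤ depth u) (sym l) z≤n
    ... | inj₂ (i , l , refl) = ≤-reflexive (trans (cong rank l) (rank-inner i))

    rank≤ : ∀ z → rank z ≤ suc t
    rank≤ zero = z≤n
    rank≤ (suc z) with splitAt q z
    ... | inj₁ i = ≤-trans (depth≤t (at i)) (n≤1+n t)
    ... | inj₂ _ = ≤-refl

    depth-parent : ∀ {x y} → parent F x ≡ just y → depth y < depth x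
    depth-parent {x} {y} e = ≤-reflexive (depth-unique (child e (proj₂ (rooted y))) (proj₂ (rooted x)))

    rank-mono : ∀ {z w} → parentᵀ z ≡ just w → rank w < rank z
    rank-mono {suc z} refl with splitAt q z
    ... | inj₂ e with e ≟ e₀
    ...   | yes _ = s≤s z≤n
    ...   | no _  = s≤s (≤-trans (rank-locate (att e)) (depth≤t (att e)))
    rank-mono {suc z} refl | inj₁ i with parent F (at i) in eq
    ...   | nothing = depth≥1 (proj₂ (rooted (at i)))
    ...   | just y  = ≤-<-trans (rank-locate y) (depth-parent eq)

    orphan⇒root : ∀ {z} → parentᵀ z ≡ nothing → z ≡ zero
    orphan⇒root {zero} _ = refl

  open ParentTree parentᵀ zero orphan⇒root rank rank-mono

  private
    parent≢leaf : ∀ z {e} → parentᵀ z ≢ just (leaf e)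
    parent≢leaf z r with view z
    ... | isInner i with parent F (at i) in eq
    ...   | nothing with trans (sym (trans (parent-inner i) (cong (λ y → just (maybe′ locate zero y)) eq))) r
    ...     | ()
    parent≢leaf z r | isInner i | just y = locate≢leaf y (just-injective (trans (sym (parent-inner-up i eq)) r))
    parent≢leaf z r | isLeaf e with e ≟ e₀
    ... | no ne = locate≢leaf (att e) (just-injective (trans (sym (parent-other ne)) r))
    ... | yes refl with trans (sym parent-e₀) r
    ...   | ()

    leaf-isLeaf : ∀ e → IsLeaf adj (leaf e)
    leaf-isLeaf e = childless⇒leaf (λ z → parent≢leaf z)

    -- Being used passes to ancestors, so the whole chain above `x` survives the pruning.
    lift : ∀ {x u} → Used x → u ⊑ x → Ancestors parentᵀ (locate x) (locate u)
    lift ux ε = ε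
    lift {x} ux@(f , f≢ , x⊑) (_◅_ {j = y} e a) with locate-used ux
    ... | i , l , refl = subst (λ z → Ancestors parentᵀ z _) (sym l)
          (parent-inner-up i e ◅ lift (f , f≢ , (x⊑ ◅◅ (e ◅ ε))) a)

    -- The converse of `lift`. The start is described through `locate` because the parent of a kept
    -- vertex is given in that form.
    lower : ∀ {z j} → Ancestors parentᵀ z (inner j) → ∀ u → locate u ≡ z → at j ⊑ u
    lower {z} a u l with locate-cases u
    lower {z} ε u l | inj₁ l′ with trans (sym l) l′
    ... | ()
    lower {z} (e ◅ a) u l | inj₁ l′ with trans (sym (cong parentᵀ (trans (sym l) l′))) e
    ... | ()
    lower {z} ε u l | inj₂ (i , l′ , refl) with inner-injective (trans (sym l) l′)
    ... | refl = ε
    lower {z} (e ◅ a) .(at i) l | inj₂ (i , l′ , refl) with parent F (at i) in eq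
    ... | just y = eq ◅ lower a y (just-injective (trans (sym (parent-inner-up i eq)) (trans (cong parentᵀ (trans (sym l′) l)) e)))
    ... | nothing with trans (sym (trans (cong parentᵀ (trans (sym l) l′))
          (trans (parent-inner i) (cong (λ y → just (maybe′ locate zero y)) eq)))) e
    lower {z} (e ◅ ()  ◅ a) .(at i) l | inj₂ (i , l′ , refl) | nothing | refl

    lower-inner : ∀ {i j} → Ancestors parentᵀ (inner i) (inner j) → at j ⊑ at i
    lower-inner {i} a = lower a (at i) (locate-at i)

    used-above : ∀ {e x} → e ≢ e₀ → Inc G e x → Used (φ x)
    used-above {e} {x} ne i = e , ne , proj₂ (attach e) x i

    leaf-up : ∀ {e u} → e ≢ e₀ → u ⊑ att e → Ancestors parentᵀ (leaf e) (locate u)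
    leaf-up {e} ne a = parent-other ne ◅ lift (e , ne , ε) a

    -- One child is the leaf of `e₀`. The path from the leaf of `e₁` enters the root through another
    -- child, since nothing has a leaf as its parent.
    root-internal : IsInternal adj zero
    root-internal with top (proj₁ (ancestors-root (leaf e₁))) (λ ()) (λ r → e₁≢e₀ (leaf-injective r))
      where
      top : ∀ {z} → Ancestors parentᵀ z zero → z ≢ zero → z ≢ leaf e₀ → ∃ λ y → y ≢ leaf e₀ × parentᵀ y ≡ just zero
      top ε ne _ = ⊥-elim (ne refl)
      top {z} (_◅_ {j = w} e a) _ ne with w ≟ zero
      ... | yes refl = z , ne , e
      ... | no w≢0   = top a w≢0 (λ { refl → parent≢leaf z e })
    ... | y , y≢ , py = two-children⇒internal y≢ py parent-e₀

    inner-internal : ∀ i → IsInternal adj (inner i)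
    inner-internal i with at-used i
    ... | e , ne , a = parent-and-child⇒internal (parent-inner i)
          (proj₂ (ancestors-last (subst (Ancestors parentᵀ (leaf e)) (locate-at i) (leaf-up ne a)) (λ r → inner≢leaf (sym r))))

    leaf-onto : ∀ z → IsLeaf adj z → ∃ λ e → leaf e ≡ z
    leaf-onto z d with view z
    ... | isRoot    = ⊥-elim (<-irrefl refl (≤-trans root-internal d))
    ... | isInner i = ⊥-elim (<-irrefl refl (≤-trans (inner-internal i) d))
    ... | isLeaf e  = e , refl

  decomposition : Decomposition (nE G)
  decomposition = record
    { nodes = suc (q + m) ; tadj = adj ; isTree = isTree′ ; hasInternal = zero , root-internal
    ; σ = leaf ; σ-inj = leaf-injective ; σ-leaf = leaf-isLeaf ; σ-onto = leaf-onto }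

  private
    -- The vertices of G meeting several parts of 𝒫_v are ancestors of att e₀ if v is, and of v otherwise.
    data Base : Node → Fin s → Set where
      moved : ∀ {v} → (∀ i → v ≡ inner i → at i ⊑ att e₀) → Base v (att e₀)
      fixed : ∀ i → ¬ (at i ⊑ att e₀) → Base (inner i) (at i)

    base : ∀ v → IsInternal adj v → ∃ (Base v)
    base v int with view v
    ... | isRoot   = att e₀ , moved λ _ ()
    ... | isLeaf e = ⊥-elim (<-irrefl refl (≤-trans int (leaf-isLeaf e)))
    ... | isInner i with at i ⊑? att e₀
    ...   | yes a = att e₀ , moved λ j r → subst (λ j → at j ⊑ att e₀) (inner-injective r) a
    ...   | no ¬a = at i , fixed i ¬a

    ancestors-of-root : ∀ {i} → ¬ Ancestors parentᵀ zero (inner i)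
    ancestors-of-root (() ◅ _)

    base-above : ∀ {v a} → Base v a → ∀ {u} → ¬ (u ⊑ a) → ∀ i → v ≡ inner i → ¬ (u ⊑ at i)
    base-above (moved above) ¬u i r b  = ¬u (above i r ◅◅ b)
    base-above (fixed i _) ¬u j r b with inner-injective r
    ... | refl = ¬u b

    -- For `e ≢ e₀` the walk climbs from the leaf to `x`; meeting `v` on the way would put `x` above
    -- `v`. The leaf of `e₀` is joined to `x` through the root; meeting `v` there would put `v`
    -- above `x`, hence above `att e₀`, which `fixed` excludes. Under `moved` an edge `e₀` at `x`
    -- would already put `x` above the base.
    walk-to-vertex : ∀ {v a} → IsInternal adj v → Base v a → ∀ {x} → ¬ (φ x ⊑ a) → Used (φ x) →
      ∀ e → Inc G e x → AvoidWalk adj v (leaf e) (locate (φ x))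
    walk-to-vertex {v} int B {x} ¬a used e e∋x with e ≟ e₀ | locate-used used
    ... | no ne | j , l , at≡ = avoid-up (leaf-up ne (proj₂ (attach e) x e∋x))
      λ _ up-v → blocked (view v) refl (subst (Ancestors parentᵀ v) l up-v)
      where
      blocked : ∀ {w} → View w → w ≡ v → Ancestors parentᵀ v (inner j) → ⊥
      blocked isRoot refl up-v = ancestors-of-root up-v
      blocked (isLeaf f) refl _ = <-irrefl refl (≤-trans int (leaf-isLeaf f))
      blocked (isInner i) refl up-v = base-above B ¬a i refl (subst (_⊑ at i) at≡ (lower-inner up-v))
    walk-to-vertex {v} int (moved _) {x} ¬a used e e∋x | yes refl | _ = ⊥-elim (¬a (proj₂ (attach e₀) x e∋x))
    walk-to-vertex {v} int (fixed i ¬i) {x} ¬a used e e∋x | yes refl | j , l , at≡ =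
      subst (AvoidWalk adj v (leaf e₀)) (sym l)
        (acons (λ r → inner≢leaf (sym r)) (adj-parent parent-e₀)
          (reverse-avoiding (avoid-up (proj₁ (ancestors-root (inner j)))
            (λ up-v _ → ¬i (proj₂ (attach e₀) x e∋x ◅◅ subst (at i ⊑_) at≡ (lower-inner up-v))))))

    boundary-above : ∀ {v a} → IsInternal adj v → Base v a → ∀ X → UnionOfParts decomposition v X → ∀ x →
      anyFin (λ e → X e ∧ incident G e x) ∧ anyFin (λ e → not (X e) ∧ incident G e x) ≡ true → φ x ⊑ a
    boundary-above {v} {a} int B X union x b =
      meet (anyFin-true (λ e → X e ∧ incident G e x) (proj₁ (∧-true b)))
           (anyFin-true (λ e → not (X e) ∧ incident G e x) (proj₂ (∧-true b)))
      where
      separated : ∀ {e f} → X e ≡ true → not (X f) ≡ true → X e ≢ X f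
      separated {e} {f} p q r = true≢false (trans (sym q) (cong not (trans (sym r) p)))
      -- At most one of two distinct edges at `x` is `e₀`; the other one keeps `φ x` in the tree.
      used : ∀ {e f} → e ≢ f → Inc G e x → Inc G f x → Used (φ x)
      used {e} {f} e≢f e∋x f∋x with e ≟ e₀
      ... | no ne    = used-above ne e∋x
      ... | yes refl = used-above (λ r → e≢f (sym r)) f∋x
      meet : (∃ λ e → X e ∧ incident G e x ≡ true) → (∃ λ f → not (X f) ∧ incident G f x ≡ true) → φ x ⊑ a
      meet (e , p) (f , r) with φ x ⊑? a
      ... | yes y = y
      ... | no ¬y = ⊥-elim (separated (proj₁ (∧-true p)) (proj₁ (∧-true r)) (union e f
              (avoidWalk-++ (walk-to-vertex int B ¬y u e e∋x) (reverse-avoiding (walk-to-vertex int B ¬y u f f∋x)))))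
        where
        e∋x = proj₂ (∧-true {X e} p)
        f∋x = proj₂ (∧-true {not (X f)} r)
        u = used (λ { refl → separated (proj₁ (∧-true p)) (proj₁ (∧-true r)) refl }) e∋x f∋x

  -- The vertices that are counted inject into the ancestors of the base, of which there are at most
  -- `t`; the bound is relaxed to match the radius.
  width : WidthAtMost (λG G) decomposition (suc t)
  width v int X union with base v int
  ... | a , B = ≤-trans (count-ancestors (proj₂ (rooted a)) (proj₁ (proj₂ closure)) (boundary-above int B X union))
                  (≤-trans (depth≤t a) (n≤1+n t))

  hasDecomposition : HasDecomposition (λG G) (suc t) (suc t)
  hasDecomposition = decomposition , width , radius rank≤

-- Both bounds combined

theorem3p5 : (G : Graph) (k t : ℕ) → IsBranchDepth G k → IsTreeDepth G t →
    (k ∸ 1 ≤ t) × (t ≤ (2 * k * k ∸ k + 1) ⊔ 2)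
-- With fewer than two edges the branch-depth is 0 by convention, so the forest is built without a
-- decomposition.
theorem3p5 G k t (inj₁ (m<2 , refl)) (_ , t-min) = z≤n , t-min 2 (few-edges⇒hasForest G m<2)
theorem3p5 G k t (inj₂ (2≤m , D , k-min)) ((F , rooted , height , closure) , t-min) =
  ∸-monoˡ-≤ 1 (k-min (suc t) (FromForest.hasDecomposition G F rooted height closure e₀ e₁ e₁≢e₀))
  , t-min _ (decomposition⇒hasForest G k D)
  where
  two : ∀ {m} → 2 ≤ m → ∃ λ (e : Fin m) → ∃ λ f → f ≢ e
  two (s≤s (s≤s _)) = zero , suc zero , λ ()
  e₀ = proj₁ (two 2≤m)
  e₁ = proj₁ (proj₂ (two 2≤m))
  e₁≢e₀ = proj₂ (proj₂ (two 2≤m))
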